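{- A lopsp-operation $O$ is $\mathbf{c}2$ if and only if every 2-cycle in the predecoration $Q(O)$ has at least one of the vertices $v_0,v_1,v_2$ on each of its two sides.
   Context: A map is a connected multigraph (loops and parallel edges allowed) 2-cell embedded in a closed orientable surface; plane means embedded in the sphere. A lopsp-operation is a plane map $O$ with a colouring $c:V_O\to\{0,1,2\}$ and three marked vertices $v_0,v_1,v_2$ such that: (1) every face of $O$ is a triangle; (2) no edge joins two vertices of the same colour; (3) $c(v_0)\neq1$, $c(v_2)\neq1$, if $c(v_1)=1$ then $\deg(v_1)=2$, and every vertex $v\notin\{v_0,v_1,v_2\}$ with $c(v)=1$ has degree 4. An edge has colour $i$ if neither endpoint has colour $i$. The predecoration $Q(O)$ is the submap of $O$ consisting of all vertices of colours 0 and 2 and all edges of colour 1, together with, if $c(v_1)=1$, the vertex $v_1$ and the edge of colour 2 incident with $v_1$. A cut-path of $O$ is a path $P$ in $O$ from $v_1$ through $v_0$ to $v_2$. Cutting $O$ open along $P$ gives a plane map $O_P$ with one new face (the outer face) whose boundary consists of two copies of $P$. The lopsp-operation $O$ is $\mathbf{c}2$ if for every cut-path $P$ of minimal length (among all cut-paths), there is no 2-cycle in $O_P$. A 2-cycle is a cycle consisting of two parallel edges; in a plane map it separates the sphere into two sides. -}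

module Defs where

open import Data.Nat using (ℕ; zero; suc; _+_; _*_; _≤_; _<_)
open import Data.Fin using (Fin; zero; suc; inject₁; fromℕ)
open import Data.Bool using (Bool; true; false)
open import Data.Product using (Σ; ∃; ∃₂; _×_; _,_; proj₁; proj₂)
open import Data.Sum using (_⊎_)
open import Relation.Nullary using (¬_)
open import Relation.Binary.PropositionalEquality using (_≡_; _≢_)
open import Relation.Binary.Construct.Closure.ReflexiveTransitive using (Star)
open import Relation.Binary.Construct.Closure.Symmetric using (SymClosure)
open import Function.Bundles using (_⇔_)

-- Combinatorial maps.  A map is given by a finite set of darts Fin n,
-- a permutation σ (rotation around vertices) and a fixed-point-free
-- involution α (the two darts of an edge).  Vertices = σ-orbits,
-- edges = α-orbits, faces = φ-orbits with φ = σ ∘ α.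

iter : ∀ {A : Set} → (A → A) → ℕ → A → A
iter f zero    x = x
iter f (suc k) x = f (iter f k x)

SameOrbit : ∀ {n} → (Fin n → Fin n) → Fin n → Fin n → Set
SameOrbit p d d' = ∃ λ k → iter p k d ≡ d'

HasOrbits : ∀ {n} → (Fin n → Fin n) → ℕ → Set
HasOrbits {n} p k =
  Σ (Fin n → Fin k) λ f →
    (∀ i → ∃ λ d → f d ≡ i) ×
    (∀ d d' → (f d ≡ f d' → SameOrbit p d d') × (SameOrbit p d d' → f d ≡ f d'))

OrbitLength : ∀ {n} → (Fin n → Fin n) → Fin n → ℕ → Set
OrbitLength p d k =
  1 ≤ k × iter p k d ≡ d × (∀ j → 1 ≤ j → j < k → iter p j d ≢ d)

record Map : Set where
  field
    n       : ℕ
    σ       : Fin n → Fin n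
    σ⁻¹     : Fin n → Fin n
    σσ⁻¹    : ∀ d → σ (σ⁻¹ d) ≡ d
    σ⁻¹σ    : ∀ d → σ⁻¹ (σ d) ≡ d
    α       : Fin n → Fin n
    α-invol : ∀ d → α (α d) ≡ d
    α-fpf   : ∀ d → α d ≢ d

  φ : Fin n → Fin n
  φ d = σ (α d)

  Step : Fin n → Fin n → Set
  Step d d' = d' ≡ σ d ⊎ d' ≡ α d

  SameVertex : Fin n → Fin n → Set
  SameVertex = SameOrbit σ

-- connected and embedded in the sphere (Euler: V - E + F = 2, E = n/2)
record PlaneMap : Set where
  field
    map : Map
  open Map map
  field
    connected : ∀ d d' → Star Step d d'
    planar    : ∃₂ λ V F → HasOrbits σ V × HasOrbits φ F × 2 * (V + F) ≡ n + 4
  open Map map public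

col0 col1 col2 : Fin 3
col0 = zero
col1 = suc zero
col2 = suc (suc zero)

record Lopsp : Set where
  field
    pm : PlaneMap
  open PlaneMap pm
  field
    c          : Fin n → Fin 3          -- colour of the vertex of a dart
    c-vertex   : ∀ d → c (σ d) ≡ c d
    triangles  : ∀ d → OrbitLength φ d 3
    proper     : ∀ d → c d ≢ c (α d)
    -- marked vertices, given by one of their darts
    v₀ v₁ v₂   : Fin n
    v₀≠v₁      : ¬ SameVertex v₀ v₁
    v₀≠v₂      : ¬ SameVertex v₀ v₂
    v₁≠v₂      : ¬ SameVertex v₁ v₂
    c-v₀       : c v₀ ≢ col1
    c-v₂       : c v₂ ≢ col1
    deg-v₁     : c v₁ ≡ col1 → OrbitLength σ v₁ 2
    deg-other  : ∀ d → c d ≡ col1 → ¬ SameVertex d v₀ → ¬ SameVertex d v₁ →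
                 ¬ SameVertex d v₂ → OrbitLength σ d 4
  open PlaneMap pm public

module LopspDefs (O : Lopsp) where
  open Lopsp O

  Dart : Set
  Dart = Fin n

  marked : Fin 3 → Dart
  marked zero             = v₀
  marked (suc zero)       = v₁
  marked (suc (suc zero)) = v₂

  -- Cut-paths.  A path of length suc m is a sequence of darts
  -- ds 0, …, ds m; its vertex sequence is vtx 0, …, vtx (suc m).

  pathVtx : ∀ {m} → (Fin (suc m) → Dart) → Fin (suc (suc m)) → Dart
  pathVtx ds zero    = ds zero
  pathVtx ds (suc i) = α (ds i)

  record CutPath : Set where
    field
      m       : ℕ
      ds      : Fin (suc m) → Dart
      start   : SameVertex (ds zero) v₁
      chain   : ∀ (i : Fin m) → SameVertex (α (ds (inject₁ i))) (ds (suc i))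
      end     : SameVertex (α (ds (fromℕ m))) v₂
      simple  : ∀ i j → SameVertex (pathVtx ds i) (pathVtx ds j) → i ≡ j
      through : ∃ λ i → SameVertex (pathVtx ds i) v₀

    len : ℕ
    len = suc m

    vtx : Fin (suc (suc m)) → Dart
    vtx = pathVtx ds

    OnPath : Dart → Set
    OnPath d = ∃ λ i → d ≡ ds i ⊎ d ≡ α (ds i)

    -- interior vertex number j (vtx (j+1)), its dart towards the
    -- previous and towards the next path vertex
    intVtx back fwdD : Fin m → Dart
    intVtx j = vtx (suc (inject₁ j))
    back   j = α (ds (inject₁ j))
    fwdD   j = ds (suc j)

    LeftAt : Fin m → Dart → Set
    LeftAt j d = ∃ λ t → iter σ t (fwdD j) ≡ d ×
                   (∀ u → u ≤ t → iter σ u (fwdD j) ≢ back j)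

    -- The underlying multigraph of O_P.  Its darts are pairs (d , s):
    -- a dart d of O not on P (with s = false), or one of the two copies
    -- s of a dart d on P.  Interior vertices of P are split into two
    -- copies; copy "true" receives the left darts and the true-copies of
    -- the path edges.

    CDart : Set
    CDart = Dart × Bool

    ValidC : CDart → Set
    ValidC (d , s) = ¬ OnPath d → s ≡ false

    SideC : Fin m → CDart → Set
    SideC j (d , s) = (OnPath d × s ≡ true) ⊎ (¬ OnPath d × LeftAt j d)

    SameVertexC : CDart → CDart → Set
    SameVertexC x y = SameVertex (proj₁ x) (proj₁ y) ×
      (∀ j → SameVertex (proj₁ x) (intVtx j) → SideC j x ⇔ SideC j y)

    SameEdgeC : CDart → CDart → Set
    SameEdgeC x y = (proj₁ y ≡ proj₁ x ⊎ proj₁ y ≡ α (proj₁ x)) × proj₂ x ≡ proj₂ y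

    revC : CDart → CDart
    revC (d , s) = (α d , s)

    HasTwoCycleCut : Set
    HasTwoCycleCut = ∃₂ λ x y → ValidC x × ValidC y × ¬ SameEdgeC x y ×
      SameVertexC x y × SameVertexC (revC x) (revC y) × ¬ SameVertexC x (revC x)

  open CutPath public

  IsC2 : Set
  IsC2 = ∀ (P : CutPath) → (∀ (P' : CutPath) → len P ≤ len P') → ¬ HasTwoCycleCut P

  InQ : Dart → Set
  InQ d = (c d ≢ col1 × c (α d) ≢ col1)
        ⊎ (c v₁ ≡ col1 × (SameVertex d v₁ ⊎ SameVertex (α d) v₁) ×
           c d ≢ col2 × c (α d) ≢ col2)

  TwoCycleQ : Dart → Dart → Set
  TwoCycleQ x y = InQ x × InQ y × x ≢ y × x ≢ α y ×
    SameVertex x y × SameVertex (α x) (α y) × ¬ SameVertex x (α x)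

  OnCycle : Dart → Dart → Dart → Set
  OnCycle x y d = SameVertex d x ⊎ SameVertex d (α x)

  -- Sides of the 2-cycle: connectivity in the sphere minus the cycle,
  -- moving inside faces (φ) or across edges (α) other than the two
  -- cycle edges.
  SideStep : Dart → Dart → Dart → Dart → Set
  SideStep x y d d' = d' ≡ φ d
    ⊎ (d' ≡ α d × d ≢ x × d ≢ α x × d ≢ y × d ≢ α y)

  SameSide : Dart → Dart → Dart → Dart → Set
  SameSide x y = Star (SymClosure (SideStep x y))

  MarkedBothSides : Dart → Dart → Set
  MarkedBothSides x y = ∃₂ λ i k →
    ¬ OnCycle x y (marked i) × ¬ OnCycle x y (marked k) ×
    ¬ SameSide x y (marked i) (marked k)

{-# OPTIONS --safe #-}

-- Planarity enters only through the Jordan property of 2-cycles: the darts can be coloured by the side of the 2-cycle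
-- that their face lies on.  If no cycle edge separated its two faces, a dual spanning tree avoiding the cycle together
-- with the remaining primal edges, one of them redundant, would connect too many points for Euler's formula.
--
-- If a 2-cycle of O_P exists, then P does not cross it in O, so P and hence all marked vertices off the cycle lie on one
-- side.  A 2-cycle avoiding colour 1 lies in Q(O); one through a vertex z of colour 1 is traded for the 2-cycle of Q(O)
-- bounding the union of its empty side and the two triangles at z outside.
--
-- Conversely, suppose one side of a 2-cycle {x, y} contains no marked vertex.  A shortest cut-path P has no vertex inside,
-- since an excursion through the inside could be replaced by x.  So either {x, y}, or {x, f} with f the edge of P inside,
-- survives in O_P.  Cut-paths exist because simple v₁-v₂ paths can be rerouted across triangles.

module Submission where

open import Defs
open import Data.Bool using (Bool; true; false)
import Data.Bool.Properties as Bool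
open import Data.Empty using (⊥; ⊥-elim)
open import Data.Fin using (Fin; zero; suc; inject₁; fromℕ; toℕ; punchIn; punchOut; _↑ˡ_; _↑ʳ_; splitAt)
open import Data.Fin.Properties as Fin using (_≟_; any?; punchOut-injective)
open import Data.List as List using (List; []; _∷_; _++_; length; lookup; filter; allFin)
open import Data.List.Properties using (length-++; length-map)
open import Data.List.Membership.Propositional using (_∈_)
open import Data.List.Membership.Propositional.Properties
  using (∈-lookup; ∈-filter⁺; ∈-filter⁻; ∈-map⁺; ∈-map⁻; ∈-allFin)
open import Data.List.Relation.Unary.Any using (here; there)
import Data.List.Relation.Unary.All as All
open import Data.List.Relation.Unary.AllPairs using (_∷_)
open import Data.List.Relation.Unary.Unique.Propositional using (Unique)
import Data.List.Relation.Unary.Unique.Propositional.Properties as Unique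
open import Data.Nat as ℕ using (ℕ; zero; suc; _+_; _*_; _≤_; _<_; z≤n; s≤s)
open import Data.Nat.Induction using (<-rec)
import Data.Nat.Properties as ℕ
open import Data.Product using (Σ; ∃; ∃₂; _×_; _,_; proj₁; proj₂)
open import Data.Sum using (_⊎_; inj₁; inj₂; [_,_]′)
open import Data.Unit using (⊤; tt)
open import Function using (_∘_; id; case_of_)
open import Function.Bundles using (_⇔_; mk⇔; Equivalence)
open import Function.Construct.Composition using (_⇔-∘_)
open import Function.Construct.Symmetry using (⇔-sym)
open import Relation.Binary.Construct.Closure.Equivalence as Eq using (EqClosure)
open import Relation.Binary.Construct.Closure.ReflexiveTransitive using (Star; ε; _◅_; _◅◅_)
open import Relation.Binary.Construct.Closure.Symmetric using (fwd; bwd)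
open import Relation.Binary.Definitions using (tri<; tri≈; tri>)
open import Relation.Binary.PropositionalEquality
open import Relation.Nullary using (¬_; Dec; yes; no; contradiction; does)
open import Relation.Nullary.Decidable using (_×-dec_; _⊎-dec_; ¬?; dec-true; dec-false)

-- Sides are read at corners. As `φ d` is `σ (α d)`, the face of `d` contains the corner just before
-- `d` in the rotation at its vertex, and the face of `α d` the corner just after it. A colour `S`
-- as in `Colouring` can therefore change during a rotation only where a dart of the cycle is
-- passed, and turning around a vertex is the basic move of most arguments below. The side of `y` is
-- the side of `α x`. So exchanging `x` and `y` exchanges the two sides, and a side without marked
-- vertices may always be taken to be that of `α x`. The difficulty with `O_P` is that a 2-cycle
-- there only says which copy of an interior vertex of `P` each cycle dart is attached to. This has
-- to be turned into colours of corners left and right of `P`, and back. For this, `LeftAt j d` is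
-- best read as a statement about gaps: the gap following `d` lies left of `P`. It holds for the
-- dart going on along `P` and fails for the dart going back.

iter-suc : ∀ {A : Set} (f : A → A) k x → iter f k (f x) ≡ f (iter f k x)
iter-suc f zero    x = refl
iter-suc f (suc k) x = cong f (iter-suc f k x)

-- Counting: darts per edge, and edges needed to connect finitely many points

lookup-injective : ∀ {A : Set} {xs : List A} → Unique xs →
  ∀ {i j} → lookup xs i ≡ lookup xs j → i ≡ j
lookup-injective (x∉xs ∷ u) {zero}  {zero}  eq = refl
lookup-injective {xs = _ ∷ xs} (x∉xs ∷ u) {zero} {suc j} eq =
  contradiction eq (All.lookup x∉xs (∈-lookup {xs = xs} j))
lookup-injective {xs = _ ∷ xs} (x∉xs ∷ u) {suc i} {zero} eq =
  contradiction (sym eq) (All.lookup x∉xs (∈-lookup {xs = xs} i))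
lookup-injective (x∉xs ∷ u) {suc i} {suc j} eq = cong suc (lookup-injective u eq)

unique-length : ∀ {n} {xs : List (Fin n)} → Unique xs → length xs ≤ n
unique-length u = Fin.injective⇒≤ (lookup-injective u)

module _ {n : ℕ} (α : Fin n → Fin n) (α-invol : ∀ d → α (α d) ≡ d) (α-fpf : ∀ d → α d ≢ d) where

  private
    lower? : ∀ d → Dec (d Data.Fin.< α d)
    lower? d = d Fin.<? α d

  halves : List (Fin n)
  halves = filter lower? (allFin n)

  ∈-halves : ∀ d → d ∈ halves ⊎ α d ∈ halves
  ∈-halves d with Fin.<-cmp d (α d)
  ... | tri< d<αd _ _ = inj₁ (∈-filter⁺ lower? (∈-allFin d) d<αd)
  ... | tri≈ _ d≡αd _ = contradiction (sym d≡αd) (α-fpf d)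
  ... | tri> _ _ αd<d =
    inj₂ (∈-filter⁺ lower? (∈-allFin (α d)) (subst (α d Data.Fin.<_) (sym (α-invol d)) αd<d))

  -- The list `halves` takes the smaller dart of each edge, so its image under `α` is disjoint from
  -- it.
  2*halves≤n : 2 * length halves ≤ n
  2*halves≤n = subst (_≤ n) len (unique-length both-unique)
    where
    halves-unique : Unique halves
    halves-unique = Unique.filter⁺ lower? (Unique.allFin⁺ n)

    α-injective : ∀ {d e} → α d ≡ α e → d ≡ e
    α-injective {d} {e} eq = trans (sym (α-invol d)) (trans (cong α eq) (α-invol e))

    both-unique : Unique (halves ++ List.map α halves)
    both-unique = Unique.++⁺ halves-unique (Unique.map⁺ α-injective halves-unique) disjoint
      where
      disjoint : ∀ {d} → ¬ (d ∈ halves × d ∈ List.map α halves)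
      disjoint (d∈ , d∈α) with ∈-map⁻ α d∈α
      ... | e , e∈ , refl = Fin.<-asym (proj₂ (∈-filter⁻ lower? {xs = allFin n} e∈))
        (subst (α e Data.Fin.<_) (α-invol e) (proj₂ (∈-filter⁻ lower? {xs = allFin n} d∈)))

    len : length (halves ++ List.map α halves) ≡ 2 * length halves
    len = trans (length-++ halves)
      (cong (length halves +_) (trans (length-map α halves) (sym (ℕ.+-identityʳ _))))

Edge : ∀ {N} → List (Fin N × Fin N) → Fin N → Fin N → Set
Edge es a b = (a , b) ∈ es

-- Induction on the edges: a loop is dropped, and any other edge is contracted by identifying `a`
-- with `b`, which costs one edge and one point.
connected-bound : ∀ N l (es : List (Fin N × Fin N)) → length es ≡ l →
  (∀ a b → EqClosure (Edge es) a b) → N ≤ suc l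
connected-bound zero          l es len conn = z≤n
connected-bound (suc zero)    l es len conn = s≤s z≤n
connected-bound (suc (suc N)) l [] len conn with conn zero (suc zero)
... | fwd () ◅ _
... | bwd () ◅ _
connected-bound (suc (suc N)) (suc l) ((a , b) ∷ es) len conn with a ≟ b
... | yes refl = ℕ.m≤n⇒m≤1+n (connected-bound (suc (suc N)) l es (ℕ.suc-injective len)
        (λ u v → Eq.fold (Eq.isEquivalence _) drop-loop (conn u v)))
  where
  drop-loop : ∀ {u v} → Edge ((a , a) ∷ es) u v → EqClosure (Edge es) u v
  drop-loop (here refl) = ε
  drop-loop (there e)   = Eq.return e
... | no a≢b = s≤s (connected-bound (suc N) l es′
        (trans (length-map _ es) (ℕ.suc-injective len)) conn′)
  where
  merge : Fin (suc (suc N)) → Fin (suc N)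
  merge v with a ≟ v
  ... | yes _   = punchOut a≢b
  ... | no  a≢v = punchOut a≢v

  merge-a : merge a ≡ merge b
  merge-a with a ≟ a | a ≟ b
  ... | yes _  | yes a≡b = contradiction a≡b a≢b
  ... | yes _  | no  _   = Fin.punchOut-cong a refl
  ... | no a≢a | _       = contradiction refl a≢a

  merge-punchIn : ∀ w → merge (punchIn a w) ≡ w
  merge-punchIn w with a ≟ punchIn a w
  ... | yes eq = contradiction (sym eq) (Fin.punchInᵢ≢i a w)
  ... | no  _  = trans (Fin.punchOut-cong a refl) (Fin.punchOut-punchIn a)

  es′ : List (Fin (suc N) × Fin (suc N))
  es′ = List.map (λ (u , v) → merge u , merge v) es

  step : ∀ {u v} → Edge ((a , b) ∷ es) u v → EqClosure (Edge es′) (merge u) (merge v)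
  step (here refl) = subst (EqClosure (Edge es′) (merge a)) merge-a ε
  step (there e)   = Eq.return (∈-map⁺ _ e)

  conn′ : ∀ u v → EqClosure (Edge es′) u v
  conn′ u v = subst₂ (EqClosure (Edge es′)) (merge-punchIn u) (merge-punchIn v)
    (Eq.gfold (Eq.isEquivalence _) merge step (conn (punchIn a u) (punchIn a v)))

-- Merges class `suc j` into class zero and renumbers the others; this is how a region of faces
-- absorbs one more face.
collapse : ∀ {k} → Fin (suc k) → Fin (suc (suc k)) → Fin (suc k)
collapse j zero = zero
collapse j (suc i) with j ≟ i
... | yes _   = zero
... | no  j≢i = suc (punchOut j≢i)

collapse-self : ∀ {k} (j : Fin (suc k)) → collapse j (suc j) ≡ zero
collapse-self j with j ≟ j
... | yes _   = refl
... | no  j≢j = contradiction refl j≢j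

collapse-zero : ∀ {k} (j : Fin (suc k)) a → collapse j a ≡ zero → a ≡ zero ⊎ a ≡ suc j
collapse-zero j zero _ = inj₁ refl
collapse-zero j (suc i) eq with j ≟ i
... | yes refl = inj₂ refl
... | no  _    = contradiction (sym eq) Fin.0≢1+n

collapse-injective : ∀ {k} (j : Fin (suc k)) a b →
  collapse j a ≢ zero → collapse j a ≡ collapse j b → a ≡ b
collapse-injective j zero b nz eq = contradiction refl nz
collapse-injective j (suc i) zero nz eq = contradiction eq nz
collapse-injective j (suc i) (suc i′) nz eq with j ≟ i | j ≟ i′
... | yes _ | _     = contradiction refl nz
... | no  _ | yes _ = contradiction eq nz
... | no  p | no  q = cong suc (punchOut-injective p q (Fin.suc-injective eq))

module Proof (O : Lopsp) where
  open Lopsp O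
  open LopspDefs O using (Dart; marked; pathVtx; CutPath; module CutPath; IsC2; InQ; TwoCycleQ; OnCycle;
    SameSide; MarkedBothSides)

  -- Vertex and face labels, and arcs of the rotation

  V F : ℕ
  V = proj₁ planar
  F = proj₁ (proj₂ planar)

  private
    vOrbits : HasOrbits σ V
    vOrbits = proj₁ (proj₂ (proj₂ planar))

    fOrbits : HasOrbits φ F
    fOrbits = proj₁ (proj₂ (proj₂ (proj₂ planar)))

  vl : Dart → Fin V
  vl = proj₁ vOrbits

  fl : Dart → Fin F
  fl = proj₁ fOrbits

  euler : 2 * (V + F) ≡ n + 4
  euler = proj₂ (proj₂ (proj₂ (proj₂ planar)))

  vl-surj : ∀ i → ∃ λ d → vl d ≡ i
  vl-surj = proj₁ (proj₂ vOrbits)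

  fl-surj : ∀ i → ∃ λ d → fl d ≡ i
  fl-surj = proj₁ (proj₂ fOrbits)

  vl⇒orbit : ∀ {d e} → vl d ≡ vl e → SameVertex d e
  vl⇒orbit = proj₁ (proj₂ (proj₂ vOrbits) _ _)

  orbit⇒vl : ∀ {d e} → SameVertex d e → vl d ≡ vl e
  orbit⇒vl = proj₂ (proj₂ (proj₂ vOrbits) _ _)

  vl-σ : ∀ d → vl (σ d) ≡ vl d
  vl-σ d = sym (orbit⇒vl (1 , refl))

  fl-φ : ∀ d → fl (φ d) ≡ fl d
  fl-φ d = sym (proj₂ (proj₂ (proj₂ fOrbits) _ _) (1 , refl))

  vl-φ : ∀ d → vl (φ d) ≡ vl (α d)
  vl-φ d = vl-σ (α d)

  φ³ : ∀ d → φ (φ (φ d)) ≡ d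
  φ³ d = proj₁ (proj₂ (triangles d))

  φα : ∀ d → φ (α d) ≡ σ d
  φα d = cong σ (α-invol d)

  σ-injective : ∀ {d e} → σ d ≡ σ e → d ≡ e
  σ-injective {d} {e} eq = trans (sym (σ⁻¹σ d)) (trans (cong σ⁻¹ eq) (σ⁻¹σ e))

  α-injective : ∀ {d e} → α d ≡ α e → d ≡ e
  α-injective {d} {e} eq = trans (sym (α-invol d)) (trans (cong α eq) (α-invol e))

  vl⇒c : ∀ {d e} → vl d ≡ vl e → c d ≡ c e
  vl⇒c eq with vl⇒orbit eq
  ... | k , refl = sym (c-iter k _)
    where
    c-iter : ∀ k d → c (iter σ k d) ≡ c d
    c-iter zero    d = refl
    c-iter (suc k) d = trans (c-vertex _) (c-iter k d)

  vl-α : ∀ d → vl d ≢ vl (α d)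
  vl-α d eq = proper d (vl⇒c eq)

  -- Rotation from the gap after a dart up to q; the darts strictly between satisfy E.
  data Arc (E : Dart → Set) (q : Dart) : Dart → Set where
    last : ∀ {d} → σ d ≡ q → Arc E q d
    next : ∀ {d} → E (σ d) → Arc E q (σ d) → Arc E q d

  Between : Dart → Dart → Dart → Set
  Between p q d = vl d ≡ vl p × d ≢ p × d ≢ q

  arc : ∀ {p q} → vl p ≡ vl q → p ≢ q → Arc (Between p q) q p
  arc {p} {q} vp≡vq p≢q = case vl⇒orbit vp≡vq of λ where
      (k , eq) → case rotate k p eq of λ where
        (inj₁ p≡q) → contradiction p≡q p≢q
        (inj₂ a)   → [ id , id ]′ (restart refl a)
    where
    rotate : ∀ k d → iter σ k d ≡ q → d ≡ q ⊎ Arc (_≢ q) q d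
    rotate zero    d eq = inj₁ eq
    rotate (suc k) d eq with σ d ≟ q
    ... | yes σd≡q = inj₂ (last σd≡q)
    ... | no  σd≢q with rotate k (σ d) (trans (iter-suc σ k d) eq)
    ...   | inj₁ σd≡q = contradiction σd≡q σd≢q
    ...   | inj₂ a    = inj₂ (next σd≢q a)

    -- The orbit leading from `p` to `q` may pass `p` again; only the part after the last visit is
    -- an arc.
    restart : ∀ {d} → vl d ≡ vl p → Arc (_≢ q) q d → Arc (Between p q) q p ⊎ Arc (Between p q) q d
    restart v (last σd≡q) = inj₂ (last σd≡q)
    restart {d} v (next σd≢q a) with restart (trans (vl-σ d) v) a | σ d ≟ p
    ... | inj₁ a′ | _        = inj₁ a′
    ... | inj₂ a′ | yes refl = inj₁ a′
    ... | inj₂ a′ | no  σd≢p = inj₂ (next (trans (vl-σ d) v , σd≢p , σd≢q) a′)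

  arc-induct : ∀ {E q p} (G : Dart → Set) → (∀ {d} → E (σ d) → G d → G (σ d)) →
    Arc E q p → G p → ∃ λ d → σ d ≡ q × G d
  arc-induct G step (last eq)  g = _ , eq , g
  arc-induct G step (next e a) g = arc-induct G step a (step e g)

  arc-refine : ∀ {E E′ q p} (G : Dart → Set) → (∀ {d} → E (σ d) → G d → G (σ d)) →
    (∀ {d} → E (σ d) → G d → E′ (σ d)) → Arc E q p → G p → Arc E′ q p
  arc-refine G step refine (last eq)  g = last eq
  arc-refine G step refine (next e a) g = next (refine e g) (arc-refine G step refine a (step e g))

  -- The two sides of a 2-cycle

  record Cyc (x y : Dart) : Set where
    field
      x≢y  : x ≢ y
      x≢αy : x ≢ α y
      vx   : vl x ≡ vl y
      vαx  : vl (α x) ≡ vl (α y)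

  OnC : Dart → Dart → Dart → Set
  OnC x y d = d ≡ x ⊎ d ≡ α x ⊎ d ≡ y ⊎ d ≡ α y

  onC? : ∀ x y d → Dec (OnC x y d)
  onC? x y d = (d ≟ x) ⊎-dec (d ≟ α x) ⊎-dec (d ≟ y) ⊎-dec (d ≟ α y)

  onC-α : ∀ {x y d} → OnC x y d → OnC x y (α d)
  onC-α (inj₁ refl)               = inj₂ (inj₁ refl)
  onC-α (inj₂ (inj₁ refl))        = inj₁ (α-invol _)
  onC-α (inj₂ (inj₂ (inj₁ refl))) = inj₂ (inj₂ (inj₂ refl))
  onC-α (inj₂ (inj₂ (inj₂ refl))) = inj₂ (inj₂ (inj₁ (α-invol _)))

  onC-α⁻ : ∀ {x y d} → OnC x y (α d) → OnC x y d
  onC-α⁻ {x} {y} {d} o = subst (OnC x y) (α-invol d) (onC-α o)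

  onC-swap : ∀ {x y d} → OnC x y d → OnC y x d
  onC-swap (inj₁ e)               = inj₂ (inj₂ (inj₁ e))
  onC-swap (inj₂ (inj₁ e))        = inj₂ (inj₂ (inj₂ e))
  onC-swap (inj₂ (inj₂ (inj₁ e))) = inj₁ e
  onC-swap (inj₂ (inj₂ (inj₂ e))) = inj₂ (inj₁ e)

  onC-rev : ∀ {x y d} → OnC (α x) (α y) d → OnC x y d
  onC-rev (inj₁ e)               = inj₂ (inj₁ e)
  onC-rev (inj₂ (inj₁ e))        = inj₁ (trans e (α-invol _))
  onC-rev (inj₂ (inj₂ (inj₁ e))) = inj₂ (inj₂ (inj₂ e))
  onC-rev (inj₂ (inj₂ (inj₂ e))) = inj₂ (inj₂ (inj₁ (trans e (α-invol _))))

  onC-rev⁻ : ∀ {x y d} → OnC x y d → OnC (α x) (α y) d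
  onC-rev⁻ {x} {y} {d} o = onC-rev (subst₂ (λ a b → OnC a b d) (sym (α-invol x)) (sym (α-invol y)) o)

  cyc-swap : ∀ {x y} → Cyc x y → Cyc y x
  cyc-swap {x} {y} C = record
    { x≢y = x≢y ∘ sym ; x≢αy = λ e → x≢αy (trans (sym (α-invol x)) (cong α (sym e)))
    ; vx = sym vx ; vαx = sym vαx }
    where open Cyc C

  cyc-rev : ∀ {x y} → Cyc x y → Cyc (α x) (α y)
  cyc-rev {x} {y} C = record
    { x≢y = x≢y ∘ α-injective ; x≢αy = λ e → x≢αy (α-injective e)
    ; vx = vαx ; vαx = subst₂ (λ a b → vl a ≡ vl b) (sym (α-invol x)) (sym (α-invol y)) vx }
    where open Cyc C

  onC⇒onCycle : ∀ {x y d} → Cyc x y → OnC x y d → OnCycle x y d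
  onC⇒onCycle C (inj₁ refl)               = inj₁ (vl⇒orbit refl)
  onC⇒onCycle C (inj₂ (inj₁ refl))        = inj₂ (vl⇒orbit refl)
  onC⇒onCycle C (inj₂ (inj₂ (inj₁ refl))) = inj₁ (vl⇒orbit (sym (Cyc.vx C)))
  onC⇒onCycle C (inj₂ (inj₂ (inj₂ refl))) = inj₂ (vl⇒orbit (sym (Cyc.vαx C)))

  onCycle-vl : ∀ {x y d e} → vl d ≡ vl e → OnCycle x y d → OnCycle x y e
  onCycle-vl v (inj₁ o) = inj₁ (vl⇒orbit (trans (sym v) (orbit⇒vl o)))
  onCycle-vl v (inj₂ o) = inj₂ (vl⇒orbit (trans (sym v) (orbit⇒vl o)))

  between⇒¬onC : ∀ {x y d} → Cyc x y → Between x y d → ¬ OnC x y d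
  between⇒¬onC C (v , d≢x , d≢y) (inj₁ e)                  = d≢x e
  between⇒¬onC C (v , d≢x , d≢y) (inj₂ (inj₁ refl))        = vl-α _ (sym v)
  between⇒¬onC C (v , d≢x , d≢y) (inj₂ (inj₂ (inj₁ e)))    = d≢y e
  between⇒¬onC C (v , d≢x , d≢y) (inj₂ (inj₂ (inj₂ refl))) = vl-α _ (trans (sym (Cyc.vx C)) (sym v))

  -- Satisfied by connectivity on a side and by equality of colours alike, so the bound of two sides
  -- is proved once for both.
  record SideEquiv (x y : Dart) (_~_ : Dart → Dart → Set) : Set where
    field
      ~refl  : ∀ {d} → d ~ d
      ~sym   : ∀ {d e} → d ~ e → e ~ d
      ~trans : ∀ {d e f} → d ~ e → e ~ f → d ~ f
      ~φ     : ∀ d → φ d ~ d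
      ~α     : ∀ d → ¬ OnC x y d → α d ~ d

    ~σ : ∀ d → σ d ~ α d
    ~σ d = subst (_~ α d) (φα d) (~φ (α d))

    -- Turning from `x` to `y` passes only darts off the cycle, so the corner after `x` and the
    -- corner before `y` lie on one side.
    sector : Cyc x y → y ~ α x
    sector C with arc-induct (λ d → α d ~ α x)
        (λ b a → ~trans (~α _ (between⇒¬onC C b)) (~trans (~σ _) a))
        (arc (Cyc.vx C) (Cyc.x≢y C)) ~refl
    ... | d , refl , αd~αx = ~trans (~σ d) αd~αx

  swap-equiv : ∀ {x y _~_} → SideEquiv x y _~_ → SideEquiv y x _~_
  swap-equiv E = record { SideEquiv E hiding (~σ ; sector ; ~α) ; ~α = λ d ¬o → SideEquiv.~α E d (¬o ∘ onC-swap) }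

  module TwoSides {x y : Dart} (C : Cyc x y) {_~_ : Dart → Dart → Set} (E : SideEquiv x y _~_) where
    open SideEquiv E

    y~αx : y ~ α x
    y~αx = sector C

    αy~x : α y ~ x
    αy~x = ~sym (SideEquiv.sector (swap-equiv E) (cyc-swap C))

    two-sides-C : ∀ {d} → OnC x y d → d ~ x ⊎ d ~ α x
    two-sides-C (inj₁ refl)               = inj₁ ~refl
    two-sides-C (inj₂ (inj₁ refl))        = inj₂ ~refl
    two-sides-C (inj₂ (inj₂ (inj₁ refl))) = inj₂ y~αx
    two-sides-C (inj₂ (inj₂ (inj₂ refl))) = inj₁ αy~x

    two-sides-α : ∀ d → d ~ x ⊎ d ~ α x → α d ~ x ⊎ α d ~ α x
    two-sides-α d s with onC? x y d
    ... | yes o  = two-sides-C (onC-α o)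
    ... | no  ¬o = [ inj₁ ∘ ~trans (~α d ¬o) , inj₂ ∘ ~trans (~α d ¬o) ]′ s

    -- A walk from `x` can change sides only by crossing a cycle edge, and by `sector` all four
    -- cycle darts lie on the sides of `x` and `α x`.
    two-sides : ∀ d → d ~ x ⊎ d ~ α x
    two-sides d = go (connected x d) (inj₁ ~refl)
      where
      go : ∀ {a b} → Star Step a b → a ~ x ⊎ a ~ α x → b ~ x ⊎ b ~ α x
      go ε s = s
      go (inj₁ refl ◅ st) s = go st
        ([ inj₁ ∘ ~trans (~σ _) , inj₂ ∘ ~trans (~σ _) ]′ (two-sides-α _ s))
      go (inj₂ refl ◅ st) s = go st (two-sides-α _ s)

  sameSide-equiv : ∀ x y → SideEquiv x y (SameSide x y)
  sameSide-equiv x y = record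
    { ~refl  = ε
    ; ~sym   = Eq.symmetric _
    ; ~trans = _◅◅_
    ; ~φ     = λ d → bwd (inj₁ refl) ◅ ε
    ; ~α     = λ d ¬o → bwd (inj₂ (refl , ¬o ∘ inj₁ , ¬o ∘ inj₂ ∘ inj₁ ,
                 ¬o ∘ inj₂ ∘ inj₂ ∘ inj₁ , ¬o ∘ inj₂ ∘ inj₂ ∘ inj₂)) ◅ ε
    }

  record Colouring (x y : Dart) : Set where
    field
      S  : Dart → Bool
      Sφ : ∀ d → S (φ d) ≡ S d
      Sα : ∀ d → ¬ OnC x y d → S (α d) ≡ S d
      Sx : S (α x) ≢ S x

    S-equiv : SideEquiv x y (λ d e → S d ≡ S e)
    S-equiv = record { ~refl = refl ; ~sym = sym ; ~trans = trans ; ~φ = Sφ ; ~α = Sα }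

  module Coloured {x y : Dart} (C : Cyc x y) (col : Colouring x y) where
    open Colouring col public
    open TwoSides C S-equiv public using () renaming (y~αx to Sy ; αy~x to Sαy)

    sameSide⇒S : ∀ {d e} → SameSide x y d e → S d ≡ S e
    sameSide⇒S = Eq.fold record { refl = refl ; sym = sym ; trans = trans } λ where
      (inj₁ refl) → sym (Sφ _)
      (inj₂ (refl , ≢x , ≢αx , ≢y , ≢αy)) → sym (Sα _ λ where
        (inj₁ e) → ≢x e
        (inj₂ (inj₁ e)) → ≢αx e
        (inj₂ (inj₂ (inj₁ e))) → ≢y e
        (inj₂ (inj₂ (inj₂ e))) → ≢αy e)

    -- There are at most two sides, and `Sx` gives those of `x` and `α x` different colours.
    S⇒sameSide : ∀ {d e} → S d ≡ S e → SameSide x y d e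
    S⇒sameSide {d} {e} eq with TwoSides.two-sides C (sameSide-equiv x y) d
                             | TwoSides.two-sides C (sameSide-equiv x y) e
    ... | inj₁ p | inj₁ q = p ◅◅ Eq.symmetric _ q
    ... | inj₂ p | inj₂ q = p ◅◅ Eq.symmetric _ q
    ... | inj₁ p | inj₂ q = contradiction (trans (sym (sameSide⇒S q)) (trans (sym eq) (sameSide⇒S p))) Sx
    ... | inj₂ p | inj₁ q = contradiction (trans (sym (sameSide⇒S p)) (trans eq (sameSide⇒S q))) Sx

    S-vertex : ∀ {d e} → ¬ OnCycle x y d → vl d ≡ vl e → S d ≡ S e
    S-vertex {d} ¬on eq = case vl⇒orbit eq of λ where (k , refl) → sym (rotate k)
      where
      rotate : ∀ k → S (iter σ k d) ≡ S d
      rotate zero    = refl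
      rotate (suc k) = trans (trans (sym (cong S (φα e))) (Sφ (α e))) (trans (Sα e ¬onC) (rotate k))
        where
        e = iter σ k d
        ve : vl d ≡ vl e
        ve = orbit⇒vl (k , refl)
        ¬onC : ¬ OnC x y e
        ¬onC = ¬on ∘ onCycle-vl {x} {y} (sym ve) ∘ onC⇒onCycle C

  -- The Jordan property of 2-cycles from Euler's formula

  module Jordan {x y : Dart} (C : Cyc x y) where

    -- Asking for a face outside class zero keeps the edge available when the tree is extended: the
    -- edge then added has both its faces in the collapsed class zero.
    PrimalEdge : ∀ {k} (U : Dart → Set) (g : Dart → Fin (suc k)) → Fin V → Fin V → Set
    PrimalEdge U g a b = ∃ λ e → ¬ U e × (g e ≢ zero ⊎ g (α e) ≢ zero) × vl e ≡ a × vl (α e) ≡ b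

    DualEdge : (U : Dart → Set) → Fin F → Fin F → Set
    DualEdge U a b = ∃ λ e → U e × fl e ≡ a × fl (α e) ≡ b

    -- A dual tree U avoiding the cycle and attaching every face to the class g = 0.  Removing the leaves first,
    -- the two ends of a tree edge stay connected along the rest of the triangle of its leaf.
    record Tree {k} (g : Dart → Fin (suc k)) : Set₁ where
      field
        U      : Dart → Set
        U?     : ∀ d → Dec (U d)
        U-α    : ∀ {d} → U d → U (α d)
        U-offC : ∀ {d} → U d → ¬ OnC x y d
        U-new  : ∀ {d} → U d → g d ≢ zero ⊎ g (α d) ≢ zero
        primal : ∀ {d} → U d → EqClosure (PrimalEdge U g) (vl d) (vl (α d))
        dual   : ∀ d → ∃ λ e → g e ≡ zero × EqClosure (DualEdge U) (fl d) (fl e)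

    trivialTree : ∀ {k} (g : Dart → Fin (suc k)) → (∀ d → g d ≡ zero) → Tree g
    trivialTree g g≡0 = record
      { U = λ _ → ⊥ ; U? = λ _ → no λ () ; U-α = λ () ; U-offC = λ () ; U-new = λ () ; primal = λ ()
      ; dual = λ d → d , g≡0 d , ε }

    φ≢ : ∀ d → φ d ≢ d
    φ≢ d eq = vl-α d (trans (sym (cong vl eq)) (vl-φ d))

    attach : ∀ {k} (g : Dart → Fin (suc (suc k))) → (∀ d → g (φ d) ≡ g d) →
      (∀ d e → g d ≡ g e → g d ≢ zero → fl d ≡ fl e) →
      ∀ d j → g d ≡ suc j → g (α d) ≡ zero → ¬ OnC x y d → Tree (collapse j ∘ g) → Tree g
    attach {k} g gφ single d j gd gαd d∉C T = record
      { U = U⁺ ; U? = λ e → T.U? e ⊎-dec (e ≟ d) ⊎-dec (e ≟ α d)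
      ; U-α = λ where
          (inj₁ u) → inj₁ (T.U-α u)
          (inj₂ (inj₁ refl)) → inj₂ (inj₂ refl)
          (inj₂ (inj₂ refl)) → inj₂ (inj₁ (α-invol d))
      ; U-offC = λ where
          (inj₁ u) → T.U-offC u
          (inj₂ (inj₁ refl)) → d∉C
          (inj₂ (inj₂ refl)) → d∉C ∘ onC-α⁻
      ; U-new = λ where
          (inj₁ u) → [ inj₁ ∘ pull , inj₂ ∘ pull ]′ (T.U-new u)
          (inj₂ (inj₁ refl)) → inj₁ d≢0
          (inj₂ (inj₂ refl)) → inj₂ (subst (λ e → g e ≢ zero) (sym (α-invol d)) d≢0)
      ; primal = λ where
          (inj₁ u) → old-primal u
          (inj₂ (inj₁ refl)) → d-primal
          (inj₂ (inj₂ refl)) → Eq.symmetric _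
            (subst (λ e → EqClosure (PrimalEdge U⁺ g) (vl e) (vl (α d))) (sym (α-invol d)) d-primal)
      ; dual = new-dual
      }
      where
      module T = Tree T
      g′ : Dart → Fin (suc k)
      g′ = collapse j ∘ g

      U⁺ : Dart → Set
      U⁺ e = T.U e ⊎ e ≡ d ⊎ e ≡ α d

      d≢0 : g d ≢ zero
      d≢0 eq = Fin.0≢1+n (trans (sym eq) gd)

      g′d : g′ d ≡ zero
      g′d = trans (cong (collapse j) gd) (collapse-self j)

      g′αd : g′ (α d) ≡ zero
      g′αd = cong (collapse j) gαd

      pull : ∀ {e} → g′ e ≢ zero → g e ≢ zero
      pull nz eq = nz (cong (collapse j) eq)

      lift-edge : ∀ {a b} → PrimalEdge T.U g′ a b → PrimalEdge U⁺ g a b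
      lift-edge (e , ¬u , nz , ea , eb) = e , ¬u⁺ , [ inj₁ ∘ pull , inj₂ ∘ pull ]′ nz , ea , eb
        where
        ¬u⁺ : ¬ U⁺ e
        ¬u⁺ (inj₁ u) = ¬u u
        ¬u⁺ (inj₂ (inj₁ refl)) = [ (λ p → p g′d) , (λ p → p g′αd) ]′ nz
        ¬u⁺ (inj₂ (inj₂ refl)) = [ (λ p → p g′αd) , (λ p → p (trans (cong g′ (α-invol d)) g′d)) ]′ nz

      old-primal : ∀ {e} → T.U e → EqClosure (PrimalEdge U⁺ g) (vl e) (vl (α e))
      old-primal u = Eq.map lift-edge (T.primal u)

      side-primal : ∀ e → e ≢ d → g e ≡ g d → EqClosure (PrimalEdge U⁺ g) (vl e) (vl (φ e))
      side-primal e e≢d ge with T.U? e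
      ... | yes u = subst (EqClosure _ (vl e)) (sym (vl-φ e)) (old-primal u)
      ... | no ¬u = subst (EqClosure _ (vl e)) (sym (vl-φ e)) (Eq.return (e , ¬u⁺ , inj₁ e≢0 , refl , refl))
        where
        e≢0 : g e ≢ zero
        e≢0 eq = d≢0 (trans (sym ge) eq)
        ¬u⁺ : ¬ U⁺ e
        ¬u⁺ (inj₁ u) = ¬u u
        ¬u⁺ (inj₂ (inj₁ eq)) = e≢d eq
        ¬u⁺ (inj₂ (inj₂ refl)) = e≢0 gαd

      d-primal : EqClosure (PrimalEdge U⁺ g) (vl d) (vl (α d))
      d-primal = Eq.symmetric _ (subst₂ (EqClosure _) (vl-φ d) (cong vl (φ³ d))
        (side-primal (φ d) (φ≢ d) (gφ d)
          ◅◅ side-primal (φ (φ d)) (λ eq → φ≢ d (sym (trans (sym (φ³ d)) (cong φ eq))))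
               (trans (gφ _) (gφ d))))

      new-dual : ∀ e → ∃ λ e₀ → g e₀ ≡ zero × EqClosure (DualEdge U⁺) (fl e) (fl e₀)
      new-dual e with T.dual e
      ... | e₀ , z , conn with collapse-zero j (g e₀) z
      ...   | inj₁ g≡0 = e₀ , g≡0 , Eq.map (λ (f , u , p) → f , inj₁ u , p) conn
      -- The dual path ends in the class just merged, which is the single face of `d`; crossing `d`
      -- leads on into class zero.
      ...   | inj₂ g≡j = α d , gαd ,
              (Eq.map (λ (f , u , p) → f , inj₁ u , p) conn
                ◅◅ Eq.return (d , inj₂ (inj₁ refl) , single d e₀ (trans gd (sym g≡j)) d≢0 , refl))

    isZero : ∀ {k} → Fin (suc k) → Bool
    isZero zero    = true
    isZero (suc _) = false

    isZero-sound : ∀ {k} (a : Fin (suc k)) → isZero a ≡ true → a ≡ zero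
    isZero-sound zero _ = refl

    isZero-cong : ∀ {k} (a b : Fin (suc k)) → (a ≡ zero → b ≡ zero) → (b ≡ zero → a ≡ zero) → isZero b ≡ isZero a
    isZero-cong zero    zero    _ _ = refl
    isZero-cong zero    (suc _) f _ = contradiction (sym (f refl)) Fin.0≢1+n
    isZero-cong (suc _) zero    _ f = contradiction (sym (f refl)) Fin.0≢1+n
    isZero-cong (suc _) (suc _) _ _ = refl

    -- Class zero is the region reached from the face of `x` without crossing the cycle; every other
    -- class is a single face waiting to be absorbed. When no face can be absorbed, either `α x` is
    -- outside and membership in the region is the colouring, or both sides are inside and the
    -- region is everything.
    grow : ∀ k (g : Dart → Fin (suc k)) → (∀ d → g (φ d) ≡ g d) → g x ≡ zero →
      (∀ d e → g d ≡ g e → g d ≢ zero → fl d ≡ fl e) → Colouring x y ⊎ Tree g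
    grow zero g gφ gx single = inj₂ (trivialTree g (λ d → all-zero (g d)))
      where
      all-zero : (i : Fin 1) → i ≡ zero
      all-zero zero = refl
    grow (suc k) g gφ gx single
      with any? (λ d → ¬? (g d ≟ zero) ×-dec (g (α d) ≟ zero) ×-dec ¬? (onC? x y d))
    ... | yes (d , gd , gαd , d∉C) with g d in eq
    ...   | zero  = contradiction refl gd
    ...   | suc j with grow k (collapse j ∘ g) (cong (collapse j) ∘ gφ) (cong (collapse j) gx)
                       (λ a b e nz → single a b (collapse-injective j (g a) (g b) nz e) (nz ∘ cong (collapse j)))
    ...     | inj₁ col = inj₁ col
    ...     | inj₂ T   = inj₂ (attach g gφ single d j eq gαd d∉C T)
    grow (suc k) g gφ gx single | no stuck = case g (α x) ≟ zero of λ where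
        (no nz) → inj₁ record
          { S = S ; Sφ = λ d → cong isZero (gφ d) ; Sα = Sα
          ; Sx = λ e → nz (isZero-sound (g (α x)) (trans e (cong isZero gx))) }
        (yes z) → inj₂ (trivialTree g λ d → isZero-sound (g d)
          ([ (λ e → trans e (cong isZero gx)) , (λ e → trans e (cong isZero z)) ]′
            (TwoSides.two-sides C S-equiv d)))
      where
      S : Dart → Bool
      S = isZero ∘ g

      closed : ∀ d → ¬ OnC x y d → g (α d) ≡ zero → g d ≡ zero
      closed d ¬o z with g d ≟ zero
      ... | yes z′ = z′
      ... | no nz  = contradiction (d , nz , z , ¬o) stuck

      Sα : ∀ d → ¬ OnC x y d → S (α d) ≡ S d
      Sα d ¬o = isZero-cong (g d) (g (α d))
        (λ z → closed (α d) (¬o ∘ onC-α⁻) (trans (cong g (α-invol d)) z)) (closed d ¬o)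

      S-equiv : SideEquiv x y (λ d e → S d ≡ S e)
      S-equiv = record { ~refl = refl ; ~sym = sym ; ~trans = trans ; ~φ = cong isZero ∘ gφ ; ~α = Sα }

    root : Dart → Fin (suc F)
    root d with fl d ≟ fl x
    ... | yes _ = zero
    ... | no  _ = suc (fl d)

    root-cong : ∀ {d e} → fl d ≡ fl e → root d ≡ root e
    root-cong {d} {e} eq with fl d ≟ fl x | fl e ≟ fl x
    ... | yes _ | yes _ = refl
    ... | yes p | no ¬q = contradiction (trans (sym eq) p) ¬q
    ... | no ¬p | yes q = contradiction (trans eq q) ¬p
    ... | no _  | no _  = cong suc eq

    root-zero : ∀ d → root d ≡ zero → fl d ≡ fl x
    root-zero d eq with fl d ≟ fl x
    ... | yes p = p
    ... | no _  = contradiction (sym eq) Fin.0≢1+n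

    root-x : root x ≡ zero
    root-x with fl x ≟ fl x
    ... | yes _ = refl
    ... | no ¬p = contradiction refl ¬p

    root-single : ∀ d e → root d ≡ root e → root d ≢ zero → fl d ≡ fl e
    root-single d e eq nz with fl d ≟ fl x | fl e ≟ fl x
    ... | yes _ | _     = contradiction refl nz
    ... | no  _ | yes _ = contradiction eq nz
    ... | no  _ | no _  = Fin.suc-injective eq

    -- Vertices and faces together form a graph on V + F points: a tree edge joins its two faces, any other edge
    -- its two ends, and the edge of x, whose ends are also joined by y, is used to link vertices with faces.
    module _ (T : Tree root) where
      open Tree T

      ends : Dart → Fin (V + F) × Fin (V + F)
      ends d with d ≟ x | d ≟ α x | U? d
      ... | yes _ | _     | _     = vl x ↑ˡ F , V ↑ʳ fl x
      ... | no  _ | yes _ | _     = V ↑ʳ fl x , vl x ↑ˡ F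
      ... | no  _ | no  _ | yes _ = V ↑ʳ fl d , V ↑ʳ fl (α d)
      ... | no  _ | no  _ | no  _ = vl d ↑ˡ F , vl (α d) ↑ˡ F

      edges : List (Fin (V + F) × Fin (V + F))
      edges = List.map ends (halves α α-invol α-fpf)

      _~_ : Fin (V + F) → Fin (V + F) → Set
      _~_ = EqClosure (Edge edges)

      ~sym : ∀ {a b} → a ~ b → b ~ a
      ~sym = Eq.symmetric _

      ends-x : ends x ≡ (vl x ↑ˡ F , V ↑ʳ fl x)
      ends-x with x ≟ x
      ... | yes _ = refl
      ... | no ¬p = contradiction refl ¬p

      ends-αx : ends (α x) ≡ (V ↑ʳ fl x , vl x ↑ˡ F)
      ends-αx with α x ≟ x | α x ≟ α x
      ... | yes p | _     = contradiction p (α-fpf x)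
      ... | no _  | yes _ = refl
      ... | no _  | no ¬p = contradiction refl ¬p

      ends-U : ∀ {d} → U d → ends d ≡ (V ↑ʳ fl d , V ↑ʳ fl (α d))
      ends-U {d} u with d ≟ x | d ≟ α x | U? d
      ... | yes p | _     | _     = contradiction (inj₁ p) (U-offC u)
      ... | no  _ | yes p | _     = contradiction (inj₂ (inj₁ p)) (U-offC u)
      ... | no  _ | no  _ | yes _ = refl
      ... | no  _ | no  _ | no ¬u = contradiction u ¬u

      ends-off : ∀ {d} → d ≢ x → d ≢ α x → ¬ U d → ends d ≡ (vl d ↑ˡ F , vl (α d) ↑ˡ F)
      ends-off {d} d≢x d≢αx ¬u with d ≟ x | d ≟ α x | U? d
      ... | yes p | _     | _     = contradiction p d≢x
      ... | no  _ | yes p | _     = contradiction p d≢αx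
      ... | no  _ | no  _ | yes u = contradiction u ¬u
      ... | no  _ | no  _ | no _  = refl

      edge : ∀ {d a b} → ends d ≡ (a , b) → ends (α d) ≡ (b , a) → a ~ b
      edge {d} eq eq′ with ∈-halves α α-invol α-fpf d
      ... | inj₁ d∈  = Eq.return (subst (_∈ edges) eq (∈-map⁺ ends d∈))
      ... | inj₂ αd∈ = ~sym (Eq.return (subst (_∈ edges) eq′ (∈-map⁺ ends αd∈)))

      link : (vl x ↑ˡ F) ~ (V ↑ʳ fl x)
      link = edge ends-x ends-αx

      dual-edge : ∀ {d} → U d → (V ↑ʳ fl d) ~ (V ↑ʳ fl (α d))
      dual-edge {d} u = edge (ends-U u)
        (trans (ends-U (U-α u)) (cong (λ e → V ↑ʳ fl (α d) , V ↑ʳ fl e) (α-invol d)))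

      plain-edge : ∀ {d} → d ≢ x → d ≢ α x → ¬ U d → (vl d ↑ˡ F) ~ (vl (α d) ↑ˡ F)
      plain-edge {d} d≢x d≢αx ¬u = edge (ends-off d≢x d≢αx ¬u)
        (trans (ends-off (λ e → d≢αx (trans (sym (α-invol d)) (cong α e))) (d≢x ∘ α-injective)
                 (λ u → ¬u (subst U (α-invol d) (U-α u))))
          (cong (λ e → vl (α d) ↑ˡ F , vl e ↑ˡ F) (α-invol d)))

      x-ends : (vl x ↑ˡ F) ~ (vl (α x) ↑ˡ F)
      x-ends = subst₂ (λ a b → (a ↑ˡ F) ~ (b ↑ˡ F)) (sym vx) (sym vαx)
        (plain-edge (x≢y ∘ sym) (λ e → x≢αy (trans (sym (α-invol x)) (cong α (sym e))))
          (λ u → U-offC u (inj₂ (inj₂ (inj₁ refl)))))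
        where open Cyc C

      off-edge : ∀ {d} → ¬ U d → (vl d ↑ˡ F) ~ (vl (α d) ↑ˡ F)
      off-edge {d} ¬u with d ≟ x | d ≟ α x
      ... | yes refl | _        = x-ends
      ... | no _     | yes refl = subst (λ e → (vl (α x) ↑ˡ F) ~ (vl e ↑ˡ F)) (sym (α-invol x)) (~sym x-ends)
      ... | no p     | no q     = plain-edge p q ¬u

      any-edge : ∀ d → (vl d ↑ˡ F) ~ (vl (α d) ↑ˡ F)
      any-edge d with U? d
      ... | no ¬u = off-edge ¬u
      ... | yes u = Eq.gfold (Eq.isEquivalence _) (_↑ˡ F) (λ where (e , ¬u , _ , refl , refl) → off-edge ¬u) (primal u)

      vertices : ∀ d → (vl x ↑ˡ F) ~ (vl d ↑ˡ F)
      vertices d = go (connected x d)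
        where
        go : ∀ {a b} → Star Step a b → (vl a ↑ˡ F) ~ (vl b ↑ˡ F)
        go ε = ε
        go {a} {b} (inj₁ refl ◅ st) = subst (λ v → (v ↑ˡ F) ~ (vl b ↑ˡ F)) (vl-σ a) (go st)
        go {a} (inj₂ refl ◅ st) = any-edge a ◅◅ go st

      faces : ∀ d → (vl x ↑ˡ F) ~ (V ↑ʳ fl d)
      faces d with dual d
      ... | e , z , conn = link ◅◅ subst (λ f → (V ↑ʳ f) ~ (V ↑ʳ fl d)) (root-zero e z)
        (~sym (Eq.gfold (Eq.isEquivalence _) (V ↑ʳ_) (λ where (_ , u , refl , refl) → dual-edge u) conn))

      from-x : ∀ i → (vl x ↑ˡ F) ~ i
      from-x i with splitAt V i in eq
      ... | inj₁ v = subst (_ ~_) (trans (cong (_↑ˡ F) (proj₂ (vl-surj v))) (Fin.splitAt⁻¹-↑ˡ eq)) (vertices _)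
      ... | inj₂ f = subst (_ ~_) (trans (cong (V ↑ʳ_) (proj₂ (fl-surj f))) (Fin.splitAt⁻¹-↑ʳ eq)) (faces _)

      -- With `n / 2` edges connecting all points, `V + F` is at most `n / 2 + 1`, one less than
      -- Euler's formula gives.
      no-tree : ⊥
      no-tree = ℕ.<-irrefl refl (begin-strict
        n + 2                         <⟨ ℕ.+-monoʳ-< n (s≤s (s≤s (s≤s z≤n))) ⟩
        n + 4                         ≡⟨ euler ⟨
        2 * (V + F)                   ≤⟨ ℕ.*-monoʳ-≤ 2 (connected-bound (V + F) l edges (length-map ends (halves α α-invol α-fpf))
                                                         (λ a b → ~sym (from-x a) ◅◅ from-x b)) ⟩
        2 * suc l                     ≡⟨ ℕ.*-suc 2 l ⟩
        2 + 2 * l                     ≡⟨ ℕ.+-comm 2 (2 * l) ⟩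
        2 * l + 2                     ≤⟨ ℕ.+-monoˡ-≤ 2 (2*halves≤n α α-invol α-fpf) ⟩
        n + 2                         ∎)
        where
        open ℕ.≤-Reasoning
        l = length (halves α α-invol α-fpf)

    colouring : Colouring x y
    colouring with grow F root (λ d → root-cong (fl-φ d)) root-x root-single
    ... | inj₁ col = col
    ... | inj₂ T   = ⊥-elim (no-tree T)

  col-swap : ∀ {x y} → Cyc x y → Colouring x y → Colouring y x
  col-swap C col = record
    { S = S ; Sφ = Sφ ; Sα = λ d ¬o → Sα d (¬o ∘ onC-swap)
    ; Sx = λ e → Sx (sym (trans (sym Sαy) (trans e Sy))) }
    where open Coloured C col

  col-rev : ∀ {x y} → Colouring x y → Colouring (α x) (α y)
  col-rev {x} col = record
    { S = S ; Sφ = Sφ ; Sα = λ d ¬o → Sα d (λ o → ¬o (onC-rev⁻ o))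
    ; Sx = λ e → Sx (trans (sym e) (cong S (α-invol x))) }
    where
    open Colouring col

  const-along : ∀ {A : Set} m (h : Fin (suc m) → A) → (∀ j → h (inject₁ j) ≡ h (suc j)) → ∀ i → h zero ≡ h i
  const-along m       h step zero    = refl
  const-along (suc m) h step (suc i) = trans (step zero) (const-along m (h ∘ suc) (step ∘ suc) i)

  -- Cut-paths that do not cross a 2-cycle

  module Along (P : CutPath) where
    open CutPath P

    vtx-injective : ∀ {i j} → vl (vtx i) ≡ vl (vtx j) → i ≡ j
    vtx-injective eq = simple _ _ (vl⇒orbit eq)

    vl-ds : ∀ i → vl (ds i) ≡ vl (vtx (inject₁ i))
    vl-ds zero    = refl
    vl-ds (suc i) = sym (orbit⇒vl (chain i))

    -- By simplicity the two coincidences would mean i = k + 1 and i + 1 = k.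
    no-turn : ∀ {i k} → vl (vtx (inject₁ i)) ≡ vl (vtx (suc k)) → vl (vtx (suc i)) ≢ vl (vtx (inject₁ k))
    no-turn {i} {k} p q = ℕ.<-irrefl refl (begin-strict
      toℕ i                 <⟨ ℕ.m<n⇒m<1+n (ℕ.n<1+n _) ⟩
      suc (suc (toℕ i))     ≡⟨ cong (suc ∘ toℕ) (vtx-injective q) ⟩
      suc (toℕ (inject₁ k)) ≡⟨ cong suc (Fin.toℕ-inject₁ k) ⟩
      suc (toℕ k)           ≡⟨ cong toℕ (vtx-injective p) ⟨
      toℕ (inject₁ i)       ≡⟨ Fin.toℕ-inject₁ i ⟩
      toℕ i                 ∎)
      where open ℕ.≤-Reasoning

    ds≢αds : ∀ {i k} → ds i ≢ α (ds k)
    ds≢αds {i} {k} eq = no-turn (trans (sym (vl-ds i)) (cong vl eq))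
      (trans (cong vl (trans (cong α eq) (α-invol (ds k)))) (vl-ds k))

    ds-injective : ∀ {i k} → vl (ds i) ≡ vl (ds k) → i ≡ k
    ds-injective {i} {k} eq =
      Fin.inject₁-injective (vtx-injective (trans (sym (vl-ds i)) (trans eq (vl-ds k))))

    onPath? : ∀ d → Dec (OnPath d)
    onPath? d = any? (λ i → (d ≟ ds i) ⊎-dec (d ≟ α (ds i)))

    on-α : ∀ {d} → OnPath d → OnPath (α d)
    on-α (i , inj₁ refl) = i , inj₂ refl
    on-α (i , inj₂ refl) = i , inj₁ (α-invol _)

    on-α⁻ : ∀ {d} → OnPath (α d) → OnPath d
    on-α⁻ {d} on = subst OnPath (α-invol d) (on-α on)

    parallel-on-path : ∀ {d e} → OnPath d → OnPath e → vl d ≡ vl e → vl (α d) ≡ vl (α e) → d ≡ e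
    parallel-on-path (i , inj₁ refl) (k , inj₁ refl) p q = cong ds (ds-injective p)
    parallel-on-path (i , inj₂ refl) (k , inj₂ refl) p q =
      cong (α ∘ ds) (ds-injective (subst₂ (λ a b → vl a ≡ vl b) (α-invol _) (α-invol _) q))
    parallel-on-path (i , inj₁ refl) (k , inj₂ refl) p q = contradiction
      (trans q (trans (cong vl (α-invol _)) (vl-ds k))) (no-turn (trans (sym (vl-ds i)) p))
    parallel-on-path (i , inj₂ refl) (k , inj₁ refl) p q = contradiction
      (trans (sym q) (trans (cong vl (α-invol _)) (vl-ds i))) (no-turn (trans (sym (vl-ds k)) (sym p)))

    back≢fwd : ∀ j → back j ≢ fwdD j
    back≢fwd j = ds≢αds ∘ sym

    vl-fwd : ∀ j → vl (fwdD j) ≡ vl (back j)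
    vl-fwd j = vl-ds (suc j)

    path-dart : ∀ {j d} → OnPath d → vl d ≡ vl (back j) → d ≡ fwdD j ⊎ d ≡ back j
    path-dart {j} (i , inj₁ refl) eq = inj₁ (cong ds (ds-injective (trans eq (sym (vl-fwd j)))))
    path-dart {j} (i , inj₂ refl) eq = inj₂ (cong (α ∘ ds) (Fin.suc-injective (vtx-injective eq)))

    fwd-on : ∀ j → OnPath (fwdD j)
    fwd-on j = suc j , inj₁ refl

    back-on : ∀ j → OnPath (back j)
    back-on j = inject₁ j , inj₂ refl

    left-fwd : ∀ j → LeftAt j (fwdD j)
    left-fwd j = 0 , refl , λ { .0 z≤n eq → back≢fwd j (sym eq) }

    ¬left-back : ∀ j → ¬ LeftAt j (back j)
    ¬left-back j (t , eq , ≢back) = ≢back t ℕ.≤-refl eq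

    left-next : ∀ {j d} → LeftAt j d → σ d ≢ back j → LeftAt j (σ d)
    left-next {j} {d} (t , eq , ≢back) σd≢ = suc t , cong σ eq , λ u u≤ → case ℕ.m≤n⇒m<n∨m≡n u≤ of λ where
      (inj₁ (s≤s u≤t)) → ≢back u u≤t
      (inj₂ refl)      → λ e → σd≢ (trans (sym (cong σ eq)) e)

    left-prev : ∀ {j d} → LeftAt j (σ d) → σ d ≢ fwdD j → LeftAt j d
    left-prev (zero  , eq , ≢back) σd≢ = contradiction (sym eq) σd≢
    left-prev (suc t , eq , ≢back) σd≢ = t , σ-injective eq , λ u u≤t → ≢back u (ℕ.m≤n⇒m≤1+n u≤t)

    left-before-back : ∀ {j d} → σ d ≡ back j → LeftAt j d
    left-before-back {j} {d} eq with arc-induct (LeftAt j) (λ (_ , _ , ≢b) l → left-next l ≢b)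
        (arc (vl-fwd j) (back≢fwd j ∘ sym)) (left-fwd j)
    ... | e , eq′ , l = subst (LeftAt j) (σ-injective (trans eq′ (sym eq))) l

    -- Otherwise the rotation would close up at `fwdD j` without meeting `back j`, which lies in the
    -- same orbit.
    ¬left-before-fwd : ∀ {j d} → σ d ≡ fwdD j → ¬ LeftAt j d
    ¬left-before-fwd {j} {d} eq (t , eq′ , ≢back) with vl⇒orbit (vl-fwd j)
    ... | k , σᵏf≡b with loop k
      where
      loop : ∀ k → ∃ λ u → u ≤ t × iter σ u (fwdD j) ≡ iter σ k (fwdD j)
      loop zero = 0 , z≤n , refl
      loop (suc k) with loop k
      ... | u , u≤t , e with ℕ.m≤n⇒m<n∨m≡n u≤t
      ...   | inj₁ u<t  = suc u , u<t , cong σ e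
      ...   | inj₂ refl = 0 , z≤n , trans (sym eq) (cong σ (trans (sym eq′) e))
    ...   | u , u≤t , e = ≢back u u≤t (trans e σᵏf≡b)

    left-arc : ∀ j → Arc (λ d → Between (fwdD j) (back j) d × LeftAt j d) (back j) (fwdD j)
    left-arc j = arc-refine (LeftAt j) (λ (_ , _ , ≢b) l → left-next l ≢b)
      (λ b@(_ , _ , ≢b) l → b , left-next l ≢b) (arc (vl-fwd j) (back≢fwd j ∘ sym)) (left-fwd j)

    right-arc : ∀ j → Arc (λ d → Between (back j) (fwdD j) d × ¬ LeftAt j d) (fwdD j) (back j)
    right-arc j = arc-refine (¬_ ∘ LeftAt j) (λ (_ , _ , ≢f) ¬l l → ¬l (left-prev l ≢f))
      (λ b@(_ , _ , ≢f) ¬l → b , λ l → ¬l (left-prev l ≢f)) (arc (sym (vl-fwd j)) (back≢fwd j)) (¬left-back j)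

    module Uncrossed {x y : Dart} (C : Cyc x y) (col : Colouring x y) where
      open Coloured C col

      flow : ∀ {p q} → Arc (¬_ ∘ OnC x y) q p → S q ≡ S (α p)
      flow a with arc-induct (λ d → S (α d) ≡ S (α _)) (λ ¬o e → trans (Sα _ ¬o) (trans (~σ _) e)) a refl
        where open SideEquiv S-equiv
      ... | d , refl , e = trans (SideEquiv.~σ S-equiv d) e

      -- The face colour beside the r-copy of the i-th path edge.
      shore : Bool → Fin (suc m) → Bool
      shore true  i = S (ds i)
      shore false i = S (α (ds i))

      -- Both cycle darts `p`, `q` are attached to the same copy of the path vertex, so the arc
      -- between the path darts on the other side is free of cycle darts and carries the colour
      -- along. If that arc does not border the shore, neither `p` nor `q` is on the path, and the
      -- colour may be taken across both path edges. `SideC` is not decided here; the decidable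
      -- equality of colours allows a proof by contradiction.
      shore-step : ∀ r j {p q s t} → (∀ {d} → vl d ≡ vl (back j) → d ≢ p → d ≢ q → ¬ OnC x y d) →
        vl p ≡ vl (back j) → vl q ≡ vl (back j) → (OnPath p → s ≡ r) → (OnPath q → t ≡ r) →
        (SideC j (p , s) ⇔ SideC j (q , t)) → shore r (inject₁ j) ≡ shore r (suc j)
      shore-step r j {p} {q} {s} {t} off vp vq sr tr p⇔q with shore r (inject₁ j) Bool.≟ shore r (suc j)
      ... | yes eq = eq
      ... | no  ne = ⊥-elim (outside r sr tr ne λ ps → inside r sr tr ne ps (Equivalence.to p⇔q ps))
        where
        inner : ∀ {d} → vl d ≡ vl (back j) → d ≢ fwdD j → d ≢ back j → ¬ OnPath d
        inner v ≢f ≢b on = [ ≢f , ≢b ]′ (path-dart on v)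

        right-off : SideC j (p , s) → SideC j (q , t) → Arc (¬_ ∘ OnC x y) (fwdD j) (back j)
        right-off ps qs = arc-refine (λ _ → ⊤) _ (λ b _ → off (proj₁ (proj₁ b)) (avoid b ps) (avoid b qs)) (right-arc j) tt
          where
          avoid : ∀ {d} → Between (back j) (fwdD j) d × ¬ LeftAt j d → ∀ {p s} → SideC j (p , s) → d ≢ p
          avoid ((v , ≢b , ≢f) , ¬l) (inj₁ (on , _)) refl = inner v ≢f ≢b on
          avoid (_ , ¬l)             (inj₂ (_ , l))  refl = ¬l l

        left-off : ¬ SideC j (p , s) → ¬ SideC j (q , t) → Arc (¬_ ∘ OnC x y) (back j) (fwdD j)
        left-off ¬ps ¬qs = arc-refine (λ _ → ⊤) _
          (λ b _ → off (trans (proj₁ (proj₁ b)) (vl-fwd j)) (avoid b ¬ps) (avoid b ¬qs)) (left-arc j) tt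
          where
          avoid : ∀ {d} → Between (fwdD j) (back j) d × LeftAt j d → ∀ {p s} → ¬ SideC j (p , s) → d ≢ p
          avoid ((v , ≢f , ≢b) , l) ¬ps refl = ¬ps (inj₂ (inner (trans v (vl-fwd j)) ≢f ≢b , l))

        path-off : ¬ OnPath p → ¬ OnPath q → S (α (fwdD j)) ≡ S (fwdD j) × S (α (back j)) ≡ S (back j)
        path-off ¬p ¬q =
          Sα _ (off (vl-fwd j) (λ { refl → ¬p (fwd-on j) }) (λ { refl → ¬q (fwd-on j) })) ,
          Sα _ (off refl (λ { refl → ¬p (back-on j) }) (λ { refl → ¬q (back-on j) }))

        inside : ∀ r → (OnPath p → s ≡ r) → (OnPath q → t ≡ r) → shore r (inject₁ j) ≢ shore r (suc j) →
          SideC j (p , s) → ¬ SideC j (q , t)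
        inside true  sr tr ne ps qs = ne (sym (trans (flow (right-off ps qs)) (cong S (α-invol _))))
        inside false sr tr ne ps qs =
          ne (sym (trans (proj₁ ends) (trans (flow (right-off ps qs)) (proj₂ ends))))
          where
          off-path : ∀ {p s} → (OnPath p → s ≡ false) → SideC j (p , s) → ¬ OnPath p
          off-path sf (inj₁ (_ , refl)) on = case sf on of λ ()
          off-path sf (inj₂ (¬on , _))  on = ¬on on
          ends = path-off (off-path sr ps) (off-path tr qs)

        outside : ∀ r → (OnPath p → s ≡ r) → (OnPath q → t ≡ r) → shore r (inject₁ j) ≢ shore r (suc j) →
          ¬ ¬ SideC j (p , s)
        outside false sr tr ne ¬ps = ne (flow (left-off ¬ps (¬ps ∘ Equivalence.from p⇔q)))
        outside true  sr tr ne ¬ps = ne (trans (cong S (sym (α-invol _)))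
          (trans (proj₂ ends) (trans (flow (left-off ¬ps (¬ps ∘ Equivalence.from p⇔q))) (proj₁ ends))))
          where
          ends = path-off (λ on → ¬ps (inj₁ (on , sr on))) (λ on → ¬ps (Equivalence.from p⇔q (inj₁ (on , tr on))))

      visit : ∀ i → ∃ λ k → vl (vtx k) ≡ vl (marked i)
      visit zero             = proj₁ through , orbit⇒vl (proj₂ through)
      visit (suc zero)       = zero , orbit⇒vl start
      visit (suc (suc zero)) = suc (fromℕ m) , orbit⇒vl end

      -- The shore has one colour along all of `P`, and a marked vertex off the cycle, being on `P`,
      -- has that colour at all its corners.
      uncrossed : ∀ {s t} → ValidC (x , s) → ValidC (y , t) →
        SameVertexC (x , s) (y , t) → SameVertexC (α x , s) (α y , t) →
        ∀ i k → ¬ OnCycle x y (marked i) → ¬ OnCycle x y (marked k) → S (marked i) ≡ S (marked k)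
      uncrossed {s} {t} xv yv atx atαx i k i∉ k∉ = trans (on-shore i i∉) (sym (on-shore k k∉))
        where
        -- Parallel edges of a simple path coincide, so at most one of `x`, `y` is on `P`, and its
        -- copy determines the shore; if neither is, the choice is arbitrary.
        copy : ∃ λ r → (OnPath x → s ≡ r) × (OnPath y → t ≡ r)
        copy with onPath? x
        ... | yes on = s , (λ _ → refl) , λ on′ →
                contradiction (parallel-on-path on on′ (Cyc.vx C) (Cyc.vαx C)) (Cyc.x≢y C)
        ... | no ¬on = t , (λ on → contradiction on ¬on) , (λ _ → refl)

        r = proj₁ copy

        step : ∀ j → shore r (inject₁ j) ≡ shore r (suc j)
        step j with vl x ≟ vl (back j) | vl (α x) ≟ vl (back j)
        ... | yes p | _ = shore-step r j
                (λ v ≢x ≢y → between⇒¬onC C (trans v (sym p) , ≢x , ≢y))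
                p (trans (sym (Cyc.vx C)) p) (proj₁ (proj₂ copy)) (proj₂ (proj₂ copy))
                (proj₂ atx j (vl⇒orbit p))
        ... | no _ | yes p = shore-step r j
                (λ v ≢x ≢y o → between⇒¬onC (cyc-rev C) (trans v (sym p) , ≢x , ≢y)
                  (onC-rev⁻ o))
                p (trans (sym (Cyc.vαx C)) p) (proj₁ (proj₂ copy) ∘ on-α⁻) (proj₂ (proj₂ copy) ∘ on-α⁻)
                (proj₂ atαx j (vl⇒orbit p))
        ... | no ≢x | no ≢αx = off-step r
          where
          ¬on : ∀ {d} → vl d ≡ vl (back j) → ¬ OnCycle x y d
          ¬on v = [ (λ o → ≢x (trans (sym (orbit⇒vl o)) v)) , (λ o → ≢αx (trans (sym (orbit⇒vl o)) v)) ]′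
          Sd : ∀ {d} → vl d ≡ vl (back j) → S (α d) ≡ S d
          Sd v = Sα _ (¬on v ∘ onC⇒onCycle C)
          b≈f : S (back j) ≡ S (fwdD j)
          b≈f = S-vertex (¬on refl) (sym (vl-fwd j))
          off-step : ∀ r → shore r (inject₁ j) ≡ shore r (suc j)
          off-step true  = trans (cong S (sym (α-invol _))) (trans (Sd refl) b≈f)
          off-step false = trans b≈f (sym (Sd (vl-fwd j)))

        on-shore : ∀ i → ¬ OnCycle x y (marked i) → S (marked i) ≡ shore r zero
        on-shore i ∉C with visit i
        ... | zero  , e = trans (S-vertex ∉C (sym e)) (both r)
          where
          both : ∀ r → S (ds zero) ≡ shore r zero
          both true  = refl
          both false = sym (Sα _ (∉C ∘ onCycle-vl {x} {y} e ∘ onC⇒onCycle C))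
        ... | suc l , e = trans (S-vertex ∉C (sym e)) (trans (both r) (sym (const-along m (shore r) step l)))
          where
          both : ∀ r → S (α (ds l)) ≡ shore r l
          both true  = Sα _ (∉C ∘ onCycle-vl {x} {y} e ∘ onC⇒onCycle C ∘ onC-α)
          both false = refl

  -- Marked vertices and the sides of a 2-cycle

  onCycle-swap : ∀ {x y d} → Cyc x y → OnCycle x y d → OnCycle y x d
  onCycle-swap C (inj₁ o) = inj₁ (vl⇒orbit (trans (orbit⇒vl o) (Cyc.vx C)))
  onCycle-swap C (inj₂ o) = inj₂ (vl⇒orbit (trans (orbit⇒vl o) (Cyc.vαx C)))

  onCycle? : ∀ x y d → Dec (OnCycle x y d)
  onCycle? x y d with vl d ≟ vl x | vl d ≟ vl (α x)
  ... | yes p | _     = yes (inj₁ (vl⇒orbit p))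
  ... | no _  | yes q = yes (inj₂ (vl⇒orbit q))
  ... | no ¬p | no ¬q = no [ ¬p ∘ orbit⇒vl , ¬q ∘ orbit⇒vl ]′

  marked-injective : ∀ i k → vl (marked i) ≡ vl (marked k) → i ≡ k
  marked-injective zero             zero             _ = refl
  marked-injective zero             (suc zero)       e = contradiction (vl⇒orbit e) v₀≠v₁
  marked-injective zero             (suc (suc zero)) e = contradiction (vl⇒orbit e) v₀≠v₂
  marked-injective (suc zero)       zero             e = contradiction (vl⇒orbit (sym e)) v₀≠v₁
  marked-injective (suc zero)       (suc zero)       _ = refl
  marked-injective (suc zero)       (suc (suc zero)) e = contradiction (vl⇒orbit e) v₁≠v₂
  marked-injective (suc (suc zero)) zero             e = contradiction (vl⇒orbit (sym e)) v₀≠v₂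
  marked-injective (suc (suc zero)) (suc zero)       e = contradiction (vl⇒orbit (sym e)) v₁≠v₂
  marked-injective (suc (suc zero)) (suc (suc zero)) _ = refl

  marked-three : ∀ {a b : Fin V} → ¬ (∀ i → vl (marked i) ≡ a ⊎ vl (marked i) ≡ b)
  marked-three two with two zero | two (suc zero) | two (suc (suc zero))
  ... | inj₁ p | inj₁ q | _      = case marked-injective zero (suc zero) (trans p (sym q)) of λ ()
  ... | inj₁ p | inj₂ _ | inj₁ r = case marked-injective zero (suc (suc zero)) (trans p (sym r)) of λ ()
  ... | inj₁ _ | inj₂ q | inj₂ r = case marked-injective (suc zero) (suc (suc zero)) (trans q (sym r)) of λ ()
  ... | inj₂ _ | inj₁ q | inj₁ r = case marked-injective (suc zero) (suc (suc zero)) (trans q (sym r)) of λ ()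
  ... | inj₂ p | inj₁ _ | inj₂ r = case marked-injective zero (suc (suc zero)) (trans p (sym r)) of λ ()
  ... | inj₂ p | inj₂ q | _      = case marked-injective zero (suc zero) (trans p (sym q)) of λ ()

  OneSide : ∀ {x y} → Colouring x y → Dart → Set
  OneSide {x} {y} col d = ∀ i → ¬ OnCycle x y (marked i) → Colouring.S col (marked i) ≡ Colouring.S col d

  -- The darts `x` and `y` lie on opposite sides, so the two alternatives are the two possible
  -- places of the marked vertices; with none off the cycle the first holds vacuously.
  one-side : ∀ {x y} (C : Cyc x y) (col : Colouring x y) → let open Colouring col in
    (∀ i k → ¬ OnCycle x y (marked i) → ¬ OnCycle x y (marked k) → S (marked i) ≡ S (marked k)) →
    OneSide col x ⊎ OneSide (col-swap C col) y
  one-side {x} {y} C col same with any? (λ i → ¬? (onCycle? x y (marked i)) ×-dec ¬? (S (marked i) Bool.≟ S x))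
    where open Coloured C col
  ... | no none = inj₁ λ i i∉ → case S (marked i) Bool.≟ S x of λ where
          (yes e) → e
          (no ne) → contradiction (i , i∉ , ne) none
    where open Coloured C col
  ... | yes (k , k∉ , ne) = inj₂ λ i i∉ → trans (same i k (i∉ ∘ onCycle-swap C) k∉)
          (case TwoSides.two-sides C S-equiv (marked k) of λ where
            (inj₁ e) → contradiction e ne
            (inj₂ e) → trans e (sym Sy))
    where open Coloured C col
  -- 2-cycles through a vertex of colour 1

  -- Consecutive parallel darts would lie on a triangle whose third edge is a loop, and a loop joins
  -- equal colours.
  parallel≢σ : ∀ {x y} → Cyc x y → y ≢ σ x
  parallel≢σ {x} C refl = vl-α e (trans (vl-φ (σ x)) (trans (sym vαx) (trans (cong vl (sym φe)) (vl-φ e))))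
    where
    open Cyc C
    e : Dart
    e = φ (σ x)
    φe : φ e ≡ α x
    φe = trans (cong (φ ∘ φ) (sym (φα x))) (φ³ (α x))

  orbit-mod2 : ∀ {x} → σ (σ x) ≡ x → ∀ k → iter σ k x ≡ x ⊎ iter σ k x ≡ σ x
  orbit-mod2 σ²x zero    = inj₁ refl
  orbit-mod2 σ²x (suc k) with orbit-mod2 σ²x k
  ... | inj₁ e = inj₂ (cong σ e)
  ... | inj₂ e = inj₁ (trans (cong σ e) σ²x)

  orbit-mod4 : ∀ {x} → σ (σ (σ (σ x))) ≡ x → ∀ k →
    iter σ k x ≡ x ⊎ iter σ k x ≡ σ x ⊎ iter σ k x ≡ σ (σ x) ⊎ iter σ k x ≡ σ (σ (σ x))
  orbit-mod4 σ⁴x zero    = inj₁ refl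
  orbit-mod4 σ⁴x (suc k) with orbit-mod4 σ⁴x k
  ... | inj₁ e               = inj₂ (inj₁ (cong σ e))
  ... | inj₂ (inj₁ e)        = inj₂ (inj₂ (inj₁ (cong σ e)))
  ... | inj₂ (inj₂ (inj₁ e)) = inj₂ (inj₂ (inj₂ (cong σ e)))
  ... | inj₂ (inj₂ (inj₂ e)) = inj₁ (trans (cong σ e) σ⁴x)

  QSeparated : Set
  QSeparated = ∀ x y → TwoCycleQ x y → MarkedBothSides x y

  module Pinched (sep : QSeparated) {x y : Dart} (C : Cyc x y) (col : Colouring x y)
    (cx : c x ≡ col1) (outer : OneSide col x) where
    open Coloured C col

    -- Only `v₁` may have colour 1, and then it has degree 2, where two parallel darts would be
    -- consecutive in the rotation.
    unmarked : ∀ i → vl (marked i) ≢ vl x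
    unmarked zero             e = c-v₀ (trans (vl⇒c e) cx)
    unmarked (suc (suc zero)) e = c-v₂ (trans (vl⇒c e) cx)
    unmarked (suc zero)       e with vl⇒orbit e | vl⇒orbit (Cyc.vx C)
    ... | k , σᵏv₁≡x | l , σˡx≡y = case orbit-mod2 σ²x l of λ where
        (inj₁ p) → Cyc.x≢y C (trans (sym p) σˡx≡y)
        (inj₂ p) → parallel≢σ C (trans (sym σˡx≡y) p)
      where
      σ²x : σ (σ x) ≡ x
      σ²x = subst (λ d → σ (σ d) ≡ d) σᵏv₁≡x
        (trans (trans (cong σ (sym (iter-suc σ k v₁))) (sym (iter-suc σ k (σ v₁))))
          (cong (iter σ k) (proj₁ (proj₂ (deg-v₁ (trans (vl⇒c e) cx))))))

    σ⁴x : σ (σ (σ (σ x))) ≡ x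
    σ⁴x = proj₁ (proj₂ (deg-other x cx (λ o → unmarked zero (sym (orbit⇒vl o)))
      (λ o → unmarked (suc zero) (sym (orbit⇒vl o))) (λ o → unmarked (suc (suc zero)) (sym (orbit⇒vl o)))))

    -- In a rotation of length 4 the darts `x` and `y` are not neighbours, by `parallel≢σ` in both
    -- orders, so they are opposite.
    σσy≡x : σ (σ y) ≡ x
    σσy≡x with vl⇒orbit (Cyc.vx C)
    ... | l , σˡx≡y with orbit-mod4 σ⁴x l
    ...   | inj₁ p               = contradiction (trans (sym p) σˡx≡y) (Cyc.x≢y C)
    ...   | inj₂ (inj₁ p)        = contradiction (trans (sym σˡx≡y) p) (parallel≢σ C)
    ...   | inj₂ (inj₂ (inj₁ p)) = trans (cong (σ ∘ σ) (trans (sym σˡx≡y) p)) σ⁴x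
    ...   | inj₂ (inj₂ (inj₂ p)) = contradiction
            (sym (trans (cong σ (trans (sym σˡx≡y) p)) σ⁴x)) (parallel≢σ (cyc-swap C))

    -- The vertex z of x has degree 4, with darts x, σ x, y, w in this order.  The two triangles on either side of w
    -- are z u b with u the other end of x and b the other end of w; their edges X and Y opposite z form a 2-cycle of Q
    -- whose side containing z consists of these triangles and the side of αx, so that no marked vertex lies inside.
    w h X Y : Dart
    w = σ y
    h = φ w
    X = φ x
    Y = α h

    φαy : φ (α y) ≡ w
    φαy = φα y

    φh : φ h ≡ α y
    φh = trans (cong (φ ∘ φ) (sym φαy)) (φ³ (α y))

    φαw : φ (α w) ≡ x
    φαw = trans (φα w) σσy≡x

    φX : φ X ≡ α w
    φX = trans (cong (φ ∘ φ) (sym φαw)) (φ³ (α w))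

    vX : vl X ≡ vl (α x)
    vX = vl-φ x

    vαX : vl (α X) ≡ vl (α w)
    vαX = trans (sym (vl-φ X)) (cong vl φX)

    vY : vl Y ≡ vl (α x)
    vY = trans (sym (vl-φ h)) (trans (cong vl φh) (sym (Cyc.vαx C)))

    vαY : vl (α Y) ≡ vl (α w)
    vαY = trans (cong vl (α-invol h)) (vl-φ w)

    vw : vl w ≡ vl x
    vw = trans (vl-σ y) (sym (Cyc.vx C))

    Triangles : Dart → Set
    Triangles d = d ≡ α y ⊎ d ≡ w ⊎ d ≡ h ⊎ d ≡ α w ⊎ d ≡ x ⊎ d ≡ X

    K : Dart → Set
    K d = S d ≡ S (α x) ⊎ Triangles d

    Kφ : ∀ {d} → K d → K (φ d)
    Kφ (inj₁ e)                                       = inj₁ (trans (Sφ _) e)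
    Kφ (inj₂ (inj₁ refl))                             = inj₂ (inj₂ (inj₁ φαy))
    Kφ (inj₂ (inj₂ (inj₁ refl)))                      = inj₂ (inj₂ (inj₂ (inj₁ refl)))
    Kφ (inj₂ (inj₂ (inj₂ (inj₁ refl))))               = inj₂ (inj₁ φh)
    Kφ (inj₂ (inj₂ (inj₂ (inj₂ (inj₁ refl)))))        = inj₂ (inj₂ (inj₂ (inj₂ (inj₂ (inj₁ φαw)))))
    Kφ (inj₂ (inj₂ (inj₂ (inj₂ (inj₂ (inj₁ refl)))))) = inj₂ (inj₂ (inj₂ (inj₂ (inj₂ (inj₂ refl)))))
    Kφ (inj₂ (inj₂ (inj₂ (inj₂ (inj₂ (inj₂ refl)))))) = inj₂ (inj₂ (inj₂ (inj₂ (inj₁ φX))))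

    Kα : ∀ {d} → ¬ OnC X Y d → K d → K (α d)
    Kα {d} ¬o (inj₁ e) with onC? x y d
    ... | no ¬c                         = inj₁ (trans (Sα d ¬c) e)
    ... | yes (inj₁ refl)               = contradiction (sym e) Sx
    ... | yes (inj₂ (inj₁ refl))        = inj₂ (inj₂ (inj₂ (inj₂ (inj₂ (inj₁ (α-invol x))))))
    ... | yes (inj₂ (inj₂ (inj₁ refl))) = inj₂ (inj₁ refl)
    ... | yes (inj₂ (inj₂ (inj₂ refl))) = contradiction (trans (sym e) Sαy) Sx
    Kα ¬o (inj₂ (inj₁ refl))                             = inj₁ (trans (cong S (α-invol y)) Sy)
    Kα ¬o (inj₂ (inj₂ (inj₁ refl)))                      = inj₂ (inj₂ (inj₂ (inj₂ (inj₁ refl))))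
    Kα ¬o (inj₂ (inj₂ (inj₂ (inj₁ refl))))               = contradiction (inj₂ (inj₂ (inj₂ (sym (α-invol h))))) ¬o
    Kα ¬o (inj₂ (inj₂ (inj₂ (inj₂ (inj₁ refl)))))        = inj₂ (inj₂ (inj₁ (α-invol w)))
    Kα ¬o (inj₂ (inj₂ (inj₂ (inj₂ (inj₂ (inj₁ refl)))))) = inj₁ refl
    Kα ¬o (inj₂ (inj₂ (inj₂ (inj₂ (inj₂ (inj₂ refl)))))) = contradiction (inj₁ refl) ¬o

    -- By `outer` no marked vertex lies strictly on the side of `α x`, the vertex z is unmarked, and
    -- the two triangles have no corners besides z, u and b.
    K-marked : ∀ i → K (marked i) → vl (marked i) ≡ vl (α x) ⊎ vl (marked i) ≡ vl (α w)
    K-marked i (inj₁ e) with onCycle? x y (marked i)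
    ... | yes (inj₁ o) = contradiction (orbit⇒vl o) (unmarked i)
    ... | yes (inj₂ o) = inj₁ (orbit⇒vl o)
    ... | no ¬o        = contradiction (trans (sym e) (outer i ¬o)) Sx
    K-marked i (inj₂ (inj₁ e))                             = inj₁ (trans (cong vl e) (sym (Cyc.vαx C)))
    K-marked i (inj₂ (inj₂ (inj₁ e)))                      = contradiction (trans (cong vl e) vw) (unmarked i)
    K-marked i (inj₂ (inj₂ (inj₂ (inj₁ e))))               = inj₂ (trans (cong vl e) (vl-φ w))
    K-marked i (inj₂ (inj₂ (inj₂ (inj₂ (inj₁ e)))))        = inj₂ (cong vl e)
    K-marked i (inj₂ (inj₂ (inj₂ (inj₂ (inj₂ (inj₁ e)))))) = contradiction (cong vl e) (unmarked i)
    K-marked i (inj₂ (inj₂ (inj₂ (inj₂ (inj₂ (inj₂ e)))))) = inj₁ (trans (cong vl e) vX)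

    KX : K X
    KX = inj₂ (inj₂ (inj₂ (inj₂ (inj₂ (inj₂ refl)))))

    Kh : K h
    Kh = inj₂ (inj₂ (inj₂ (inj₁ refl)))

    K-side : ∀ {d e} → SameSide X Y d e → K d → K e
    K-side ε k = k
    K-side (fwd (inj₁ refl) ◅ st) k = K-side st (Kφ k)
    K-side (bwd (inj₁ refl) ◅ st) k = K-side st (subst K (φ³ _) (Kφ (Kφ k)))
    K-side (fwd (inj₂ (refl , p , q , r , s)) ◅ st) k = K-side st (Kα [ p , [ q , [ r , s ]′ ]′ ]′ k)
    K-side (bwd (inj₂ (refl , p , q , r , s)) ◅ st) k = K-side st
      (subst K (α-invol _) (Kα ([ p , [ q , [ r , s ]′ ]′ ]′ ∘ onC-α⁻) k))

    XY : X ≢ Y → Cyc X Y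
    XY X≢Y = record
      { x≢y = X≢Y ; x≢αy = λ e → vl-α X (trans (trans vX (sym vY)) (sym (cong vl (trans (cong α e) (α-invol Y)))))
      ; vx = trans vX (sym vY) ; vαx = trans vαX (sym vαY) }

    absurd : ⊥
    absurd with X ≟ Y
    -- If X and Y are the same edge, nothing bounds `K`: it contains all darts, which leaves only u
    -- and b for three distinct marked vertices.
    ... | yes X≡Y = marked-three (λ i → K-marked i (all-K (connected X (marked i)) KX))
      where
      Kα′ : ∀ {d} → K d → K (α d)
      Kα′ {d} k with onC? X Y d
      ... | no ¬o = Kα ¬o k
      ... | yes (inj₁ refl)               = subst K (sym (trans (cong α X≡Y) (α-invol h))) Kh
      ... | yes (inj₂ (inj₁ refl))        = subst K (sym (α-invol X)) KX
      ... | yes (inj₂ (inj₂ (inj₁ refl))) = subst K (sym (α-invol h)) Kh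
      ... | yes (inj₂ (inj₂ (inj₂ refl))) = subst K (trans X≡Y (sym (α-invol Y))) KX
      all-K : ∀ {d e} → Star Step d e → K d → K e
      all-K ε k = k
      all-K (inj₁ refl ◅ st) k = all-K st (subst K (φα _) (Kφ (Kα′ k)))
      all-K (inj₂ refl ◅ st) k = all-K st (Kα′ k)
    ... | no X≢Y = case sep X Y twoCycle of λ where
        (i , k , i∉ , k∉ , apart) → apart (to-αX i i∉ ◅◅ Eq.symmetric _ (to-αX k k∉))
      where
      CXY = XY X≢Y
      in-Q : ∀ {d} → vl d ≡ vl (α x) → vl (α d) ≡ vl (α w) → InQ d
      in-Q p q = inj₁ ((λ e → proper x (trans cx (trans (sym e) (vl⇒c p)))) ,
                       (λ e → proper w (trans (trans (vl⇒c vw) cx) (trans (sym e) (vl⇒c q)))))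
      twoCycle : TwoCycleQ X Y
      twoCycle = in-Q vX vαX , in-Q vY vαY , X≢Y , Cyc.x≢αy CXY ,
        vl⇒orbit (Cyc.vx CXY) , vl⇒orbit (Cyc.vαx CXY) , vl-α X ∘ orbit⇒vl
      to-αX : ∀ i → ¬ OnCycle X Y (marked i) → SameSide X Y (marked i) (α X)
      to-αX i i∉ with TwoSides.two-sides CXY (sameSide-equiv X Y) (marked i)
      ... | inj₂ s = s
      ... | inj₁ s with K-marked i (K-side (Eq.symmetric _ s) KX)
      ...   | inj₁ e = contradiction (inj₁ (vl⇒orbit (trans e (sym vX)))) i∉
      ...   | inj₂ e = contradiction (inj₂ (vl⇒orbit (trans e (sym vαX)))) i∉

  pinched : QSeparated → ∀ {x y} → Cyc x y → (col : Colouring x y) → let open Colouring col in c x ≡ col1 →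
    (∀ i k → ¬ OnCycle x y (marked i) → ¬ OnCycle x y (marked k) → S (marked i) ≡ S (marked k)) → ⊥
  pinched sep C col cx same with one-side C col same
  ... | inj₁ outer = Pinched.absurd sep C col cx outer
  ... | inj₂ outer = Pinched.absurd sep (cyc-swap C) (col-swap C col) (trans (sym (vl⇒c (Cyc.vx C))) cx) outer

  -- From 2-cycles of the cut-open map to 2-cycles of the original map

  fromℕ-or-inject₁ : ∀ {m} (l : Fin (suc m)) → l ≡ fromℕ m ⊎ ∃ λ j → l ≡ inject₁ j
  fromℕ-or-inject₁ {zero}  zero    = inj₁ refl
  fromℕ-or-inject₁ {suc m} zero    = inj₂ (zero , refl)
  fromℕ-or-inject₁ {suc m} (suc l) with fromℕ-or-inject₁ l
  ... | inj₁ e       = inj₁ (cong suc e)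
  ... | inj₂ (j , e) = inj₂ (suc j , cong suc e)

  module _ (P : CutPath) where
    open CutPath P
    open Along P

    -- On a path of one edge `v₀` would have to be an end, that is `v₁` or `v₂`.
    has-interior : ¬ zero ≡ fromℕ m
    has-interior z with through
    ... | zero  , e = v₀≠v₁ (vl⇒orbit (trans (sym (orbit⇒vl e)) (orbit⇒vl start)))
    ... | suc l , e with fromℕ-or-inject₁ l
    ...   | inj₁ refl       = v₀≠v₂ (vl⇒orbit (trans (sym (orbit⇒vl e)) (orbit⇒vl end)))
    ...   | inj₂ (j , _)    = no-Fin z j
      where
      no-Fin : ∀ {m} → zero ≡ fromℕ m → ¬ Fin m
      no-Fin {suc m} () _

    -- At an interior vertex of the path the two copies of a path edge are separated.
    interior-end : ∀ {d} → OnPath d → ∃ λ j → vl d ≡ vl (back j) ⊎ vl (α d) ≡ vl (back j)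
    interior-end (i , e) with ends i
      where
      ends : ∀ i → ∃ λ j → vl (ds i) ≡ vl (back j) ⊎ vl (α (ds i)) ≡ vl (back j)
      ends (suc i) = i , inj₁ (vl-fwd i)
      ends zero with fromℕ-or-inject₁ (zero {m})
      ... | inj₁ z       = contradiction z has-interior
      ... | inj₂ (j , e) = j , inj₂ (cong (vl ∘ α ∘ ds) e)
    interior-end (i , inj₁ refl) | j , v      = j , v
    interior-end (i , inj₂ refl) | j , inj₁ v = j , inj₂ (trans (cong vl (α-invol _)) v)
    interior-end (i , inj₂ refl) | j , inj₂ v = j , inj₁ v

    agree : ∀ {j d s t} → OnPath d → SideC j (d , s) ⇔ SideC j (d , t) → s ≡ t
    agree {s = false} {false} on s⇔t = refl
    agree {s = true}  {true}  on s⇔t = refl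
    agree {s = true}  {false} on s⇔t with Equivalence.to s⇔t (inj₁ (on , refl))
    ... | inj₂ (¬on , _) = contradiction on ¬on
    agree {s = false} {true}  on s⇔t with Equivalence.from s⇔t (inj₁ (on , refl))
    ... | inj₂ (¬on , _) = contradiction on ¬on

    copies-agree : ∀ {d s t} → OnPath d → SameVertexC (d , s) (d , t) → SameVertexC (α d , s) (α d , t) → s ≡ t
    copies-agree on at₁ at₂ with interior-end on
    ... | j , inj₁ v = agree on (proj₂ at₁ j (vl⇒orbit v))
    ... | j , inj₂ v = agree (on-α on) (proj₂ at₂ j (vl⇒orbit v))

    -- Two copies of one path edge are never parallel in the cut-open map, so a 2-cycle there uses
    -- two different edges of the original.
    twoCycle⇒cyc : ∀ {x y s t} → ValidC (x , s) → ValidC (y , t) → ¬ SameEdgeC (x , s) (y , t) →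
      SameVertexC (x , s) (y , t) → SameVertexC (α x , s) (α y , t) → Cyc x y
    twoCycle⇒cyc {x} {y} {s} {t} xv yv ≢e at₁ at₂ = record
      { x≢y  = λ { refl → case onPath? x of λ where
          (yes on) → ≢e (inj₁ refl , copies-agree on at₁ at₂)
          (no ¬on) → ≢e (inj₁ refl , trans (xv ¬on) (sym (yv ¬on))) }
      ; x≢αy = λ { refl → vl-α y (sym (orbit⇒vl (proj₁ at₁))) }
      ; vx   = orbit⇒vl (proj₁ at₁)
      ; vαx  = orbit⇒vl (proj₁ at₂) }

    separated⇒¬twoCycle : QSeparated → ¬ HasTwoCycleCut
    separated⇒¬twoCycle sep ((x , s) , (y , t) , xv , yv , ≢e , at₁ , at₂ , _) = go (c x ≟ col1) (c (α x) ≟ col1)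
      where
      C : Cyc x y
      C = twoCycle⇒cyc xv yv ≢e at₁ at₂
      col : Colouring x y
      col = Jordan.colouring C
      open Coloured C col
      same : ∀ i k → ¬ OnCycle x y (marked i) → ¬ OnCycle x y (marked k) → S (marked i) ≡ S (marked k)
      same = Uncrossed.uncrossed C col xv yv at₁ at₂
      go : Dec (c x ≡ col1) → Dec (c (α x) ≡ col1) → ⊥
      go (yes cx) _ = pinched sep C col cx same
      go (no _) (yes cαx) = pinched sep (cyc-rev C) (col-rev col) cαx
        (λ i k i∉ k∉ → same i k (i∉ ∘ onCycle-rev) (k∉ ∘ onCycle-rev))
        where
        onCycle-rev : ∀ {d} → OnCycle x y d → OnCycle (α x) (α y) d
        onCycle-rev (inj₁ o) = inj₂ (subst (SameVertex _) (sym (α-invol x)) o)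
        onCycle-rev (inj₂ o) = inj₁ o
      go (no c≢) (no cα≢) = case sep x y
          ( inj₁ (c≢ , cα≢)
          , inj₁ ((λ e → c≢ (trans (vl⇒c (Cyc.vx C)) e)) , (λ e → cα≢ (trans (vl⇒c (Cyc.vαx C)) e)))
          , Cyc.x≢y C , Cyc.x≢αy C , proj₁ at₁ , proj₁ at₂ , vl-α x ∘ orbit⇒vl) of λ where
        (i , k , i∉ , k∉ , apart) → apart (S⇒sameSide (same i k i∉ k∉))

    -- From a side without path edges to a 2-cycle of the cut-open map

    forward? : ∀ d → Dec (∃ λ i → d ≡ ds i)
    forward? d = any? (λ i → d ≟ ds i)

    out : Dart → Bool
    out = does ∘ forward?

    out-ds : ∀ i → out (ds i) ≡ true
    out-ds i = dec-true (forward? (ds i)) (i , refl)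

    out-αds : ∀ i → out (α (ds i)) ≡ false
    out-αds i = dec-false (forward? (α (ds i))) λ (_ , e) → ds≢αds (sym e)

    out-off : ∀ d → ¬ OnPath d → out d ≡ false
    out-off d ¬on = dec-false (forward? d) λ (i , e) → ¬on (i , inj₁ e)

    -- The copy `out p` attaches `p` to the side of the path on which the gap after `p` lies. This
    -- only needs a check when `p` is one of the two path darts.
    side-first : ∀ {j p} → vl p ≡ vl (back j) → SideC j (p , out p) ⇔ LeftAt j p
    side-first {j} {p} v with onPath? p
    ... | no ¬on = mk⇔ [ (λ (on , _) → contradiction on ¬on) , proj₂ ]′ (λ l → inj₂ (¬on , l))
    ... | yes on with path-dart on v
    ...   | inj₁ refl = mk⇔ (λ _ → left-fwd j) (λ _ → inj₁ (on , out-ds (suc j)))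
    ...   | inj₂ refl = mk⇔
            [ (λ (_ , e) → case trans (sym e) (out-αds (inject₁ j)) of λ ()) , (λ (¬on , _) → contradiction on ¬on) ]′
            (λ l → contradiction l (¬left-back j))

    -- Mirror image of `side-first`: the opposite copy attaches `q` to the side of the gap before
    -- `q`, which is the gap after `g`.
    side-last : ∀ {j q g} → vl q ≡ vl (back j) → σ g ≡ q → SideC j (q , out (α q)) ⇔ LeftAt j g
    side-last {j} {q} {g} v σg≡q with onPath? q
    ... | no ¬on = mk⇔
            [ (λ (on , _) → contradiction on ¬on)
            , (λ (_ , l) → left-prev (subst (LeftAt j) (sym σg≡q) l) (λ e → off (fwd-on j) (trans (sym σg≡q) e))) ]′
            (λ l → inj₂ (¬on , subst (LeftAt j) σg≡q (left-next l (λ e → off (back-on j) (trans (sym σg≡q) e)))))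
      where
      off : ∀ {d} → OnPath d → q ≢ d
      off on refl = ¬on on
    ... | yes on with path-dart on v
    ...   | inj₁ refl = mk⇔
            [ (λ (_ , e) → case trans (sym e) (out-αds (suc j)) of λ ()) , (λ (¬on , _) → contradiction on ¬on) ]′
            (λ l → contradiction l (¬left-before-fwd σg≡q))
    ...   | inj₂ refl = mk⇔ (λ _ → left-before-back σg≡q)
            (λ _ → inj₁ (on , trans (cong out (α-invol _)) (out-ds (inject₁ j))))

    left-through : ∀ {j q g} → Arc (λ d → vl d ≡ vl (back j) × ¬ OnPath d) q g →
      ∃ λ e → σ e ≡ q × (LeftAt j g ⇔ LeftAt j e)
    left-through {j} {g = g} a = arc-induct (λ e → LeftAt j g ⇔ LeftAt j e)
      (λ (_ , ¬on) g⇔e → mk⇔ (λ l → left-next l λ { e → ¬on (subst OnPath (sym e) (back-on j)) })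
                              (λ l → left-prev l λ { e → ¬on (subst OnPath (sym e) (fwd-on j)) }) ⇔-∘ g⇔e)
      a (mk⇔ id id)

    OnOuterSide : ∀ {x y} → Colouring x y → Dart → Set
    OnOuterSide {x} {y} col d = ∀ i → ¬ OnC x y (ds i) → Colouring.S col (ds i) ≡ Colouring.S col d

    -- Darts strictly between `p` and `q` are on the side of `α p`, where no path edge lies, so the
    -- gap after `p` and the gap before `q` are on the same side of the path.
    same-side : ∀ {p q} → Cyc p q → (col : Colouring p q) → OnOuterSide col p →
      ∀ j → vl p ≡ vl (back j) → SideC j (p , out p) ⇔ SideC j (q , out (α q))
    same-side {p} {q} C col outer j vp with left-through off-arc
      where
      open Coloured C col
      outer-dart : ∀ {d} → OnPath d → ¬ OnC p q d → S d ≡ S p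
      outer-dart (i , inj₁ refl) ¬o = outer i ¬o
      outer-dart (i , inj₂ refl) ¬o = trans (Sα _ (¬o ∘ onC-α)) (outer i (¬o ∘ onC-α))
      off-arc : Arc (λ d → vl d ≡ vl (back j) × ¬ OnPath d) q p
      off-arc = arc-refine (λ d → S (α d) ≡ S (α p))
        (λ b e → trans (Sα _ (between⇒¬onC C b)) (trans (SideEquiv.~σ S-equiv _) e))
        (λ b@(v , _) e → trans v vp , λ on →
          Sx (trans (sym (trans (SideEquiv.~σ S-equiv _) e)) (outer-dart on (between⇒¬onC C b))))
        (arc (Cyc.vx C) (Cyc.x≢y C)) refl
    ... | e , σe≡q , p⇔e = ⇔-sym (side-last (trans (sym (Cyc.vx C)) vp) σe≡q) ⇔-∘ (p⇔e ⇔-∘ side-first vp)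

    -- Every dart inside the cycle at x's vertex lies after x and before y, at the other vertex after α y and before α x;
    -- so x must be cut on the side where its copy is the left one exactly if x is directed along the path, and y oppositely.
    outer⇒twoCycle : ∀ {x y} → Cyc x y → (col : Colouring x y) → OnOuterSide col x → HasTwoCycleCut
    outer⇒twoCycle {x} {y} C col outer = (x , out x) , (y , out (α y)) , out-off x ,
      (λ ¬on → out-off (α y) (¬on ∘ on-α⁻)) ,
      (λ { (inj₁ e , _) → Cyc.x≢y C (sym e)
         ; (inj₂ e , _) → Cyc.x≢αy C (trans (sym (α-invol x)) (cong α (sym e))) }) ,
      (vl⇒orbit (Cyc.vx C) , λ j v → same-side C col outer j (orbit⇒vl v)) ,
      (vl⇒orbit (Cyc.vαx C) , λ j v → ⇔-sym
        (subst (λ d → SideC j (α y , out (α y)) ⇔ SideC j (α x , out d)) (α-invol x)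
          (same-side C′ col′ outer′ j (trans (sym (Cyc.vαx C)) (orbit⇒vl v))))) ,
      λ (v , _) → vl-α x (orbit⇒vl v)
      where
      C′ : Cyc (α y) (α x)
      C′ = cyc-rev (cyc-swap C)
      col′ : Colouring (α y) (α x)
      col′ = col-rev (col-swap C col)
      outer′ : OnOuterSide col′ (α y)
      outer′ i ¬o = trans (outer i (λ o → ¬o (onC-rev⁻ (onC-swap o)))) (sym (Coloured.Sαy C col))

    module _ {x y : Dart} (C : Cyc x y) (col : Colouring x y) where
      open Coloured C col

      NoInnerVertex : Set
      NoInnerVertex = ∀ k → ¬ OnCycle x y (vtx k) → S (vtx k) ≡ S x

      -- With no path vertex strictly inside, both ends of an inner path edge lie on the cycle, and
      -- they differ as there are no loops.
      inner-parallel : NoInnerVertex → ∀ {d} → OnPath d → ¬ OnC x y d → S d ≢ S x →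
        (vl d ≡ vl x × vl (α d) ≡ vl (α x)) ⊎ (vl (α d) ≡ vl x × vl d ≡ vl (α x))
      inner-parallel none {d} on ∉C inner = ends (on-cycle on inner)
        (on-cycle (on-α on) (inner ∘ trans (sym (Sα d ∉C))))
        where
        on-cycle : ∀ {d} → OnPath d → S d ≢ S x → OnCycle x y d
        on-cycle {d} on ne with onCycle? x y d
        ... | yes o = o
        ... | no ¬o = contradiction (at-vertex on) ne
          where
          at-vertex : OnPath d → S d ≡ S x
          at-vertex (i , inj₁ refl) = trans (S-vertex ¬o (vl-ds i))
            (none (inject₁ i) (¬o ∘ onCycle-vl {x} {y} (sym (vl-ds i))))
          at-vertex (i , inj₂ refl) = none (suc i) ¬o
        ends : OnCycle x y d → OnCycle x y (α d) → _
        ends (inj₁ p) (inj₁ q) = contradiction (trans (orbit⇒vl p) (sym (orbit⇒vl q))) (vl-α d)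
        ends (inj₁ p) (inj₂ q) = inj₁ (orbit⇒vl p , orbit⇒vl q)
        ends (inj₂ p) (inj₁ q) = inj₂ (orbit⇒vl q , orbit⇒vl p)
        ends (inj₂ p) (inj₂ q) = contradiction (trans (orbit⇒vl p) (sym (orbit⇒vl q))) (vl-α d)

      -- A path edge f inside the cycle is parallel to x, and the cycle x f has no path edge inside.
      parallel⇒twoCycle : NoInnerVertex → ∀ {f} → OnPath f → ¬ OnC x y f → S f ≢ S x →
        vl f ≡ vl x → vl (α f) ≡ vl (α x) → HasTwoCycleCut
      parallel⇒twoCycle none {f} on ∉C inner vf vαf = outer⇒twoCycle C′ col′ outer
        where
        C′ : Cyc x f
        C′ = record { x≢y = λ { refl → ∉C (inj₁ refl) } ; x≢αy = λ { e → vl-α f (trans vf (cong vl e)) }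
                    ; vx = sym vf ; vαx = sym vαf }
        col′ : Colouring x f
        col′ = Jordan.colouring C′
        module S′ = Colouring col′

        off : ∀ {d} → S d ≡ S x → d ≢ x → d ≢ α x → ¬ OnC x f d
        off Sd ≢x ≢αx (inj₁ e)                  = ≢x e
        off Sd ≢x ≢αx (inj₂ (inj₁ e))           = ≢αx e
        off Sd ≢x ≢αx (inj₂ (inj₂ (inj₁ refl))) = inner Sd
        off Sd ≢x ≢αx (inj₂ (inj₂ (inj₂ refl))) = inner (trans (sym (Sα f ∉C)) Sd)

        -- On the side of `x` a walk can meet neither `f` nor `α f`, which lie inside; hence it
        -- stays on one side of the new cycle as well.
        keep : ∀ {a b} → SameSide x y a b → S a ≡ S x → S′.S a ≡ S′.S b
        keep ε Sa = refl
        keep (st@(fwd (inj₁ refl)) ◅ sts) Sa = trans (sym (S′.Sφ _)) (keep sts (trans (sym (sameSide⇒S (st ◅ ε))) Sa))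
        keep (st@(bwd (inj₁ refl)) ◅ sts) Sa = trans (S′.Sφ _) (keep sts (trans (sym (sameSide⇒S (st ◅ ε))) Sa))
        keep (st@(fwd (inj₂ (refl , ≢x , ≢αx , _))) ◅ sts) Sa =
          trans (sym (S′.Sα _ (off Sa ≢x ≢αx))) (keep sts (trans (sym (sameSide⇒S (st ◅ ε))) Sa))
        keep (st@(bwd (inj₂ (refl , ≢x , ≢αx , _))) ◅ sts) Sa =
          trans (S′.Sα _ (off Sb ≢x ≢αx)) (keep sts Sb)
          where Sb = trans (sym (sameSide⇒S (st ◅ ε))) Sa

        only-f : ∀ {d} → OnPath d → vl d ≡ vl x → vl (α d) ≡ vl (α x) → d ≡ f
        only-f on′ p q = parallel-on-path on′ on (trans p (sym vf)) (trans q (sym vαf))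

        only-αf : ∀ {d} → OnPath d → vl (α d) ≡ vl x → vl d ≡ vl (α x) → d ≡ α f
        only-αf {d} on′ p q = trans (sym (α-invol d))
          (cong α (only-f (on-α on′) p (trans (cong vl (α-invol d)) q)))

        outer-dart : ∀ {d} → OnPath d → ¬ OnC x f d → S d ≡ S x
        outer-dart {d} on′ ¬o with onC? x y d
        ... | yes (inj₁ e)                  = contradiction (inj₁ e) ¬o
        ... | yes (inj₂ (inj₁ e))           = contradiction (inj₂ (inj₁ e)) ¬o
        ... | yes (inj₂ (inj₂ (inj₁ refl))) =
          contradiction (inj₂ (inj₂ (inj₁ (only-f on′ (sym (Cyc.vx C)) (sym (Cyc.vαx C)))))) ¬o
        ... | yes (inj₂ (inj₂ (inj₂ refl))) = contradiction (inj₂ (inj₂ (inj₂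
          (only-αf on′ (trans (cong vl (α-invol y)) (sym (Cyc.vx C))) (sym (Cyc.vαx C)))))) ¬o
        ... | no d∉C with S d Bool.≟ S x
        ...   | yes e = e
        ...   | no ne with inner-parallel none on′ d∉C ne
        ...     | inj₁ (p , q) = contradiction (inj₂ (inj₂ (inj₁ (only-f on′ p q)))) ¬o
        ...     | inj₂ (p , q) = contradiction (inj₂ (inj₂ (inj₂ (only-αf on′ p q)))) ¬o

        outer : OnOuterSide col′ x
        outer i ¬o = keep (S⇒sameSide Si) Si
          where Si = outer-dart (i , inj₁ refl) ¬o

      noInner⇒twoCycle : NoInnerVertex → HasTwoCycleCut
      noInner⇒twoCycle none with any? (λ i → ¬? (onC? x y (ds i)) ×-dec ¬? (S (ds i) Bool.≟ S x))
      ... | no nothing = outer⇒twoCycle C col λ i ¬o → case S (ds i) Bool.≟ S x of λ where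
              (yes e) → e
              (no ne) → contradiction (i , ¬o , ne) nothing
      ... | yes (i , ¬o , ne) with inner-parallel none (i , inj₁ refl) ¬o ne
      ...   | inj₁ (p , q) = parallel⇒twoCycle none (i , inj₁ refl) ¬o ne p q
      ...   | inj₂ (p , q) = parallel⇒twoCycle none (i , inj₂ refl) (¬o ∘ onC-α⁻)
              (ne ∘ trans (sym (Sα (ds i) ¬o))) p (trans (cong vl (α-invol (ds i))) q)

  -- Simple paths and the existence of cut-paths

  data Path (w : Fin V) : Fin V → ℕ → Set where
    []   : ∀ {u} → u ≡ w → Path w u 0
    step : ∀ {u v m} d → vl d ≡ u → vl (α d) ≡ v → Path w v m → Path w u (suc m)

  _on_ : ∀ {w u m} → Fin V → Path w u m → Set
  _on_ {u = u} z ([] _)         = z ≡ u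
  _on_ {u = u} z (step _ _ _ p) = z ≡ u ⊎ z on p

  Simple : ∀ {w u m} → Path w u m → Set
  Simple ([] _)                 = ⊤
  Simple {u = u} (step _ _ _ p) = ¬ u on p × Simple p

  start-on : ∀ {w u m} (p : Path w u m) → u on p
  start-on ([] _)         = refl
  start-on (step _ _ _ p) = inj₁ refl

  on? : ∀ {w u m} z (p : Path w u m) → Dec (z on p)
  on? {u = u} z ([] _)         = z ≟ u
  on? {u = u} z (step _ _ _ p) = (z ≟ u) ⊎-dec on? z p

  suffix : ∀ {w u m z} (p : Path w u m) → Simple p → z on p →
    ∃ λ l → Σ (Path w z l) λ q → Simple q × (∀ {t} → t on q → t on p)
  suffix p@([] _)         s       refl        = _ , p , s , id
  suffix p@(step _ _ _ _) s       (inj₁ refl) = _ , p , s , id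
  suffix (step _ _ _ p)   (_ , s) (inj₂ z∈p) with suffix p s z∈p
  ... | l , q , qs , q⊆p = l , q , qs , inj₂ ∘ q⊆p

  -- Whichever of `b`, `r` the path meets first, it is led from there through `z` to the other one;
  -- the segment skipped may be lost, but `b` and `z` are on the new path.
  insert : ∀ {w u m b r z} d e → vl d ≡ b → vl (α d) ≡ z → vl e ≡ z → vl (α e) ≡ r →
    (p : Path w u m) → Simple p → b on p → r on p → ¬ z on p → b ≢ r →
    ∃ λ l → Σ (Path w u l) λ q → Simple q × b on q × z on q × (∀ {t} → t on q → t on p ⊎ t ≡ z)
  insert d e db dz ez er ([] _) s refl refl z∉ b≢r = contradiction refl b≢r
  insert {u = u} {b = b} {r} {z} d e db dz ez er (step f fu fv p) (u∉p , s) b∈ r∈ z∉ b≢r with b ≟ u | r ≟ u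
  ... | yes refl | yes refl = contradiction refl b≢r
  insert d e db dz ez er (step f fu fv p) (u∉p , s) b∈ (inj₁ refl) z∉ b≢r | yes refl | no r≢u = contradiction refl r≢u
  insert d e db dz ez er (step f fu fv p) (u∉p , s) b∈ (inj₂ r∈p) z∉ b≢r | yes refl | no _ with suffix p s r∈p
  ... | l , q , qs , q⊆p = _ , step d db dz (step e ez er q) ,
        ([ z∉ ∘ inj₁ ∘ sym , u∉p ∘ q⊆p ]′ , z∉ ∘ inj₂ ∘ q⊆p , qs) , inj₁ refl , inj₂ (inj₁ refl) ,
        λ { (inj₁ refl) → inj₁ (inj₁ refl) ; (inj₂ (inj₁ refl)) → inj₂ refl ; (inj₂ (inj₂ t∈)) → inj₁ (inj₂ (q⊆p t∈)) }
  insert d e db dz ez er (step f fu fv p) (u∉p , s) (inj₁ refl) r∈ z∉ b≢r | no b≢u | yes refl = contradiction refl b≢u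
  insert d e db dz ez er (step f fu fv p) (u∉p , s) (inj₂ b∈p) r∈ z∉ b≢r | no _ | yes refl with suffix p s b∈p
  ... | l , q , qs , q⊆p = _ , step (α e) er (trans (cong vl (α-invol e)) ez)
          (step (α d) dz (trans (cong vl (α-invol d)) db) q) ,
        ([ z∉ ∘ inj₁ ∘ sym , u∉p ∘ q⊆p ]′ , z∉ ∘ inj₂ ∘ q⊆p , qs) ,
        inj₂ (inj₂ (start-on q)) , inj₂ (inj₁ refl) ,
        λ { (inj₁ refl) → inj₁ (inj₁ refl) ; (inj₂ (inj₁ refl)) → inj₂ refl ; (inj₂ (inj₂ t∈)) → inj₁ (inj₂ (q⊆p t∈)) }
  insert d e db dz ez er (step f fu fv p) (u∉p , s) b∈ r∈ z∉ b≢r | no b≢u | no r≢u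
    with insert d e db dz ez er p s (case b∈ of λ { (inj₁ q) → contradiction q b≢u ; (inj₂ q) → q })
           (case r∈ of λ { (inj₁ q) → contradiction q r≢u ; (inj₂ q) → q }) (z∉ ∘ inj₂) b≢r
  ... | l , q , qs , b∈q , z∈q , q⊆ = _ , step f fu fv q ,
        ((λ u∈q → [ u∉p , z∉ ∘ inj₁ ∘ sym ]′ (q⊆ u∈q)) , qs) , inj₂ b∈q , inj₂ z∈q ,
        λ { (inj₁ refl) → inj₁ (inj₁ refl) ; (inj₂ t∈) → [ inj₁ ∘ inj₂ , inj₂ ]′ (q⊆ t∈) }

  -- The invariant concerns an edge because rerouting over a triangle needs two of its corners on
  -- the path; connectivity then spreads it to a dart at `v₀`.
  Good : Dart → Set
  Good d = ∃ λ m → Σ (Path (vl v₂) (vl v₁) m) λ p → Simple p × vl d on p × vl (α d) on p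

  good-α : ∀ {d} → Good d → Good (α d)
  good-α {d} (m , p , s , d∈ , αd∈) = m , p , s , αd∈ , subst (λ e → vl e on p) (sym (α-invol d)) d∈

  -- The triangle at d, σ d reroutes the path through the end of σ d.
  good-σ : ∀ {d} → Good d → Good (σ d)
  good-σ {d} (m , p , s , d∈ , αd∈) with on? (vl (α (σ d))) p
  ... | yes z∈ = m , p , s , subst (_on p) (sym (vl-σ d)) d∈ , z∈
  ... | no z∉ with insert (σ d) e (vl-σ d) refl (vl-φ (σ d)) er p s d∈ αd∈ z∉ (vl-α d)
    where
    e = φ (σ d)
    er : vl (α e) ≡ vl (α d)
    er = trans (sym (vl-φ e)) (cong vl (trans (cong (φ ∘ φ) (sym (φα d))) (φ³ (α d))))
  ...   | l , q , qs , d∈q , z∈q , _ = l , q , qs , subst (_on q) (sym (vl-σ d)) d∈q , z∈q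

  good-connected : ∀ {d e} → Star Step d e → Good d → Good e
  good-connected ε g               = g
  good-connected (inj₁ refl ◅ st) g = good-connected st (good-σ g)
  good-connected (inj₂ refl ◅ st) g = good-connected st (good-α g)

  -- The walk is made simple as it is read: on returning to a vertex of the path, the path is cut
  -- back to its suffix from there.
  simple-path : ∀ {d e} → Star Step d e → (∃ λ m → Σ (Path (vl v₂) (vl d) m) Simple) →
    ∃ λ m → Σ (Path (vl v₂) (vl e) m) Simple
  simple-path ε p = p
  simple-path {d} (inj₁ refl ◅ st) p =
    simple-path st (subst (λ v → ∃ λ m → Σ (Path (vl v₂) v m) Simple) (sym (vl-σ d)) p)
  simple-path {d} (inj₂ refl ◅ st) (m , p , s) with on? (vl (α d)) p
  ... | no  ∉p = simple-path st (_ , step (α d) refl (cong vl (α-invol d)) p , ∉p , s)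
  ... | yes ∈p with suffix p s ∈p
  ...   | l , q , qs , _ = simple-path st (l , q , qs)

  some-good : ∃ Good
  some-good with simple-path (connected v₂ v₁) (0 , [] refl , tt)
  ... | _ , [] e , _               = contradiction (vl⇒orbit e) v₁≠v₂
  ... | _ , p@(step d du dv q) , s = d , _ , p , s , inj₁ du , inj₂ (subst (_on q) (sym dv) (start-on q))

  v₀-path : ∃ λ m → Σ (Path (vl v₂) (vl v₁) m) λ p → Simple p × vl v₀ on p
  v₀-path with good-connected (connected (proj₁ some-good) v₀) (proj₂ some-good)
  ... | m , p , s , v₀∈ , _ = m , p , s , v₀∈

  darts : ∀ {w u m} → Path w u m → Fin m → Dart
  darts (step d _ _ p) zero    = d
  darts (step d _ _ p) (suc i) = darts p i

  vert : ∀ {w u m} → Path w u m → Fin (suc m) → Fin V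
  vert {u = u} p        zero    = u
  vert (step _ _ _ p)   (suc i) = vert p i

  vert-on : ∀ {w u m} (p : Path w u m) i → vert p i on p
  vert-on p              zero    = start-on p
  vert-on (step _ _ _ p) (suc i) = inj₂ (vert-on p i)

  on-vert : ∀ {w u m z} (p : Path w u m) → z on p → ∃ λ i → vert p i ≡ z
  on-vert ([] _)         refl        = zero , refl
  on-vert (step _ _ _ p) (inj₁ refl) = zero , refl
  on-vert (step _ _ _ p) (inj₂ z∈)   with on-vert p z∈
  ... | i , e = suc i , e

  vert-injective : ∀ {w u m} (p : Path w u m) → Simple p → ∀ i j → vert p i ≡ vert p j → i ≡ j
  vert-injective p              s        zero    zero    e = refl
  vert-injective (step _ _ _ p) (u∉ , s) zero    (suc j) e = contradiction (subst (_on p) (sym e) (vert-on p j)) u∉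
  vert-injective (step _ _ _ p) (u∉ , s) (suc i) zero    e = contradiction (subst (_on p) e (vert-on p i)) u∉
  vert-injective (step _ _ _ p) (u∉ , s) (suc i) (suc j) e = cong suc (vert-injective p s i j e)

  darts-start : ∀ {w u m} (p : Path w u m) i → vl (darts p i) ≡ vert p (inject₁ i)
  darts-start (step _ du _ p) zero    = du
  darts-start (step _ _  _ p) (suc i) = darts-start p i

  darts-end : ∀ {w u m} (p : Path w u m) i → vl (α (darts p i)) ≡ vert p (suc i)
  darts-end (step _ _ dv p) zero    = dv
  darts-end (step _ _ _  p) (suc i) = darts-end p i

  vert-last : ∀ {w u m} (p : Path w u m) → vert p (fromℕ m) ≡ w
  vert-last ([] e)         = e
  vert-last (step _ _ _ p) = vert-last p

  pathVtx-vert : ∀ {w u m} (p : Path w u (suc m)) i → vl (pathVtx (darts p) i) ≡ vert p i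
  pathVtx-vert p zero    = darts-start p zero
  pathVtx-vert p (suc i) = darts-end p i

  toCut : ∀ {m} (p : Path (vl v₂) (vl v₁) (suc m)) → Simple p → vl v₀ on p → CutPath
  toCut {m} p s v₀∈ = record
    { m       = m
    ; ds      = darts p
    ; start   = vl⇒orbit (darts-start p zero)
    ; chain   = λ i → vl⇒orbit (trans (darts-end p (inject₁ i)) (sym (darts-start p (suc i))))
    ; end     = vl⇒orbit (trans (darts-end p (fromℕ m)) (vert-last p))
    ; simple  = λ i j o → vert-injective p s i j
        (trans (sym (pathVtx-vert p i)) (trans (orbit⇒vl o) (pathVtx-vert p j)))
    ; through = case on-vert p v₀∈ of λ where (i , e) → i , vl⇒orbit (trans (pathVtx-vert p i) e)
    }

  Chained : ∀ {m} → (Fin (suc m) → Dart) → Set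
  Chained {m} ds = ∀ (i : Fin m) → vl (α (ds (inject₁ i))) ≡ vl (ds (suc i))

  fromDarts : ∀ {w u} m (ds : Fin (suc m) → Dart) → Chained ds →
    vl (ds zero) ≡ u → vl (α (ds (fromℕ m))) ≡ w → Path w u (suc m)
  fromDarts zero    ds ch eu ew = step (ds zero) eu ew ([] refl)
  fromDarts (suc m) ds ch eu ew = step (ds zero) eu refl (fromDarts m (ds ∘ suc) (ch ∘ suc) (sym (ch zero)) ew)

  pathVtx-tail : ∀ {m} (ds : Fin (suc (suc m)) → Dart) → Chained ds →
    ∀ i → vl (pathVtx (ds ∘ suc) i) ≡ vl (pathVtx ds (suc i))
  pathVtx-tail ds ch zero    = sym (ch zero)
  pathVtx-tail ds ch (suc i) = refl

  fromDarts-vert : ∀ {w u} m (ds : Fin (suc m) → Dart) (ch : Chained ds)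
    (eu : vl (ds zero) ≡ u) (ew : vl (α (ds (fromℕ m))) ≡ w) i →
    vl (pathVtx ds i) ≡ vert (fromDarts m ds ch eu ew) i
  fromDarts-vert m       ds ch eu ew zero       = eu
  fromDarts-vert zero    ds ch eu ew (suc zero) = ew
  fromDarts-vert (suc m) ds ch eu ew (suc i)    = trans (sym (pathVtx-tail ds ch i))
    (fromDarts-vert m (ds ∘ suc) (ch ∘ suc) (sym (ch zero)) ew i)

  vert-simple : ∀ {w u m} (p : Path w u m) → (∀ i j → vert p i ≡ vert p j → i ≡ j) → Simple p
  vert-simple ([] _)         inj = tt
  vert-simple (step _ _ _ p) inj =
    (λ u∈ → case on-vert p u∈ of λ where (i , e) → Fin.0≢1+n (inj zero (suc i) (sym e))) ,
    vert-simple p (λ i j e → Fin.suc-injective (inj (suc i) (suc j) e))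

  -- Shortest cut-paths

  module Shorten {x y : Dart} (C : Cyc x y) (col : Colouring x y) where
    open Coloured C col

    Inner : Fin V → Set
    Inner v = ∃ λ d → vl d ≡ v × ¬ OnCycle x y d × S d ≢ S x

    inner? : ∀ v → Dec (Inner v)
    inner? v = any? (λ d → (vl d ≟ v) ×-dec ¬? (onCycle? x y d) ×-dec ¬? (S d Bool.≟ S x))

    inner-S : ∀ {d} → Inner (vl d) → ¬ OnCycle x y d × S d ≢ S x
    inner-S {d} (e , ve , e∉ , ne) = (e∉ ∘ onCycle-vl {x} {y} (sym ve)) , ne ∘ trans (S-vertex e∉ ve)

    inner-step : ∀ d → Inner (vl d) → ¬ Inner (vl (α d)) → vl (α d) ≡ vl x ⊎ vl (α d) ≡ vl (α x)
    inner-step d inn out with onCycle? x y (α d)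
    ... | yes (inj₁ o) = inj₁ (orbit⇒vl o)
    ... | yes (inj₂ o) = inj₂ (orbit⇒vl o)
    ... | no ¬o = contradiction (α d , refl , ¬o , λ e → proj₂ (inner-S inn) (trans (sym Sαd) e)) out
      where
      Sαd : S (α d) ≡ S d
      Sαd = Sα d (proj₁ (inner-S inn) ∘ onC⇒onCycle C)

    Gate : Dart → Set
    Gate g = g ≡ x ⊎ g ≡ α x

    gate : ∀ {d} → Inner (vl d) → ¬ Inner (vl (α d)) → ∃ λ g → Gate g × vl g ≡ vl (α d)
    gate {d} inn out with inner-step d inn out
    ... | inj₁ e = x , inj₁ refl , sym e
    ... | inj₂ e = α x , inj₂ refl , sym e

    gates : ∀ {g h} → Gate g → Gate h → vl h ≡ vl g ⊎ vl h ≡ vl (α g)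
    gates (inj₁ refl) (inj₁ refl) = inj₁ refl
    gates (inj₁ refl) (inj₂ refl) = inj₂ refl
    gates (inj₂ refl) (inj₁ refl) = inj₂ (cong vl (sym (α-invol x)))
    gates (inj₂ refl) (inj₂ refl) = inj₁ refl

    Shortcut : ∀ {w u m} → Path w u m → Fin V → Set
    Shortcut {w} {m = m} p v = ∃ λ l → Σ (Path w v l) λ q → l < m × Simple q ×
      (∀ {t} → t on q → t on p) × (∀ {t} → ¬ Inner t → t on p → t on q)

    -- The vertex of `g`, through which the inside was entered, is not met again, so the path leaves
    -- through the other cycle vertex. Only inner vertices are dropped.
    exit : ∀ {w u m g} (p : Path w u m) → Simple p → Inner u → ¬ Inner w → Gate g → ¬ vl g on p → Shortcut p (vl (α g))
    exit ([] refl) s inn out _ _ = contradiction inn out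
    exit (step {v = v} d refl refl p) (_ , s) inn out gg g∉ with inner? v
    ... | yes inn′ with exit p s inn′ out gg (g∉ ∘ inj₂)
    ...   | l , q , l<m , qs , q⊆p , keep = l , q , ℕ.m<n⇒m<1+n l<m , qs , inj₂ ∘ q⊆p ,
            λ ¬inn → λ where
              (inj₁ refl) → contradiction inn ¬inn
              (inj₂ t∈)   → keep ¬inn t∈
    exit {g = g} (step d refl refl p) (_ , s) inn out gg g∉ | no ¬inn with gate inn ¬inn
    ... | h , gh , vh with gates gg gh
    ...   | inj₁ e = contradiction (inj₂ (subst (_on p) (trans (sym vh) e) (start-on p))) g∉
    ...   | inj₂ e = subst (Shortcut (step d refl refl p)) (trans (sym vh) e)
            (_ , p , ℕ.n<1+n _ , s , inj₂ , λ ¬inn → λ where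
              (inj₁ refl) → contradiction inn ¬inn
              (inj₂ t∈)   → t∈)

    -- The first excursion inside has at least two edges and runs between the two cycle vertices, so
    -- the single dart `x` or `α x` replaces it with a gain.
    shorten : ∀ {w u m z} (p : Path w u m) → Simple p → ¬ Inner u → ¬ Inner w → z on p → Inner z → Shortcut p u
    shorten ([] refl) s ¬u ¬w refl inn = contradiction inn ¬u
    shorten (step {v = v} d du dv p) (u∉ , s) ¬u ¬w z∈ inn with inner? v
    shorten (step d refl refl p) (u∉ , s) ¬u ¬w z∈ inn | yes inn′
      with gate inn′ (subst (¬_ ∘ Inner) (cong vl (sym (α-invol d))) ¬u)
    ... | g , gg , vg with trans vg (cong vl (α-invol d))
    ... | e with exit p s inn′ ¬w gg (subst (λ v → ¬ v on p) (sym e) u∉)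
    ... | l , q , l<m , qs , q⊆p , keep = suc l , step g e refl q , s≤s l<m , (u∉ ∘ q⊆p , qs) ,
          [ inj₁ , inj₂ ∘ q⊆p ]′ , λ ¬inn → [ inj₁ , inj₂ ∘ keep ¬inn ]′
    shorten (step d du dv p) (u∉ , s) ¬u ¬w (inj₁ refl) inn | no _ = contradiction inn ¬u
    shorten (step d du dv p) (u∉ , s) ¬u ¬w (inj₂ z∈) inn | no ¬v with shorten p s ¬v ¬w z∈ inn
    ... | l , q , l<m , qs , q⊆p , keep = suc l , step d du dv q , s≤s l<m , (u∉ ∘ q⊆p , qs) ,
          [ inj₁ , inj₂ ∘ q⊆p ]′ , λ ¬inn → [ inj₁ , inj₂ ∘ keep ¬inn ]′

  Shortest : CutPath → Set
  Shortest P = ∀ P′ → CutPath.len P ≤ CutPath.len P′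

  -- No marked vertex is inner, so a shortened path still has its ends and `v₀` and would be a
  -- shorter cut-path.
  shortest⇒noInner : ∀ {x y} (C : Cyc x y) (col : Colouring x y) → OneSide col x →
    ∀ P → Shortest P → NoInnerVertex P C col
  shortest⇒noInner {x} {y} C col outer P shortest k k∉ with Colouring.S col (CutPath.vtx P k) Bool.≟ Colouring.S col x
  ... | yes e = e
  ... | no ne = ⊥-elim (too-short (shorten p p-simple (outside (suc zero)) (outside (suc (suc zero))) (on-p k) (_ , refl , k∉ , ne)))
    where
    open Shorten C col
    open CutPath P
    chained : Chained ds
    chained i = orbit⇒vl (chain i)
    p : Path (vl v₂) (vl v₁) (suc m)
    p = fromDarts m ds chained (orbit⇒vl start) (orbit⇒vl end)
    vtx-vert : ∀ i → vl (vtx i) ≡ vert p i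
    vtx-vert = fromDarts-vert m ds chained (orbit⇒vl start) (orbit⇒vl end)
    p-simple : Simple p
    p-simple = vert-simple p λ i j e → simple i j (vl⇒orbit (trans (vtx-vert i) (trans e (sym (vtx-vert j)))))
    on-p : ∀ i → vl (vtx i) on p
    on-p i = subst (_on p) (sym (vtx-vert i)) (vert-on p i)
    outside : ∀ i → ¬ Inner (vl (marked i))
    outside i inn = proj₂ (inner-S inn) (outer i (proj₁ (inner-S inn)))
    too-short : ¬ Shortcut p (vl v₁)
    too-short (zero , [] e , _) = v₁≠v₂ (vl⇒orbit e)
    too-short (suc l , q , l<m , qs , _ , keep) = ℕ.<⇒≱ l<m (shortest (toCut q qs
      (keep (outside zero) (subst (_on p) (orbit⇒vl (proj₂ through)) (on-p (proj₁ through))))))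

  -- The property c2 separates the marked vertices

  module _ (c2 : IsC2) where

    oneSide-impossible : ∀ {x y} → Cyc x y → (col : Colouring x y) → ¬ OneSide col x
    oneSide-impossible C col outer = case v₀-path of λ where
        (zero  , [] e , _)     → v₁≠v₂ (vl⇒orbit e)
        (suc m , p , s , v₀∈) → descend (suc m) (toCut p s v₀∈) refl
      where
      descend : ∀ l P → CutPath.len P ≡ l → ⊥
      -- As the goal is absurdity, descent replaces the search for a minimum: the induction
      -- hypothesis refutes every shorter cut-path, so the current one is shortest.
      descend = <-rec _ λ l shorter P len≡l → go P λ P′ lt → shorter (subst (CutPath.len P′ <_) len≡l lt) P′ refl
        where
        go : ∀ P → (∀ P′ → CutPath.len P′ < CutPath.len P → ⊥) → ⊥
        go P shorter = c2 P shortest (noInner⇒twoCycle P C col (shortest⇒noInner C col outer P shortest))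
          where
          shortest : Shortest P
          shortest P′ = ℕ.≮⇒≥ (shorter P′)

    c2⇒separated : QSeparated
    c2⇒separated x y (_ , _ , x≢y , x≢αy , vx , vαx , _) = separate (any? λ i → any? λ k →
        ¬? (onCycle? x y (marked i)) ×-dec ¬? (onCycle? x y (marked k)) ×-dec ¬? (S (marked i) Bool.≟ S (marked k)))
      where
      C : Cyc x y
      C = record { x≢y = x≢y ; x≢αy = x≢αy ; vx = orbit⇒vl vx ; vαx = orbit⇒vl vαx }
      col : Colouring x y
      col = Jordan.colouring C
      open Coloured C col
      separate : Dec (∃₂ λ i k → ¬ OnCycle x y (marked i) × ¬ OnCycle x y (marked k) × S (marked i) ≢ S (marked k)) →
        MarkedBothSides x y
      separate (yes (i , k , i∉ , k∉ , ne)) = i , k , i∉ , k∉ , ne ∘ sameSide⇒S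
      separate (no none) = ⊥-elim
        ([ oneSide-impossible C col , oneSide-impossible (cyc-swap C) (col-swap C col) ]′ (one-side C col same))
        where
        same : ∀ i k → ¬ OnCycle x y (marked i) → ¬ OnCycle x y (marked k) → S (marked i) ≡ S (marked k)
        same i k i∉ k∉ with S (marked i) Bool.≟ S (marked k)
        ... | yes e = e
        ... | no ne = contradiction (i , k , i∉ , k∉ , ne) none

theorem9 : (O : Lopsp) → let open LopspDefs O in
    IsC2 ⇔ (∀ x y → TwoCycleQ x y → MarkedBothSides x y)
theorem9 O = mk⇔ c2⇒separated (λ sep P _ → separated⇒¬twoCycle P sep)
  where open Proof O
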